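{- Let $\Pi$ be a partition of $[n]$ with at least two blocks and no blocks of size $1$. Then for all integers $i\ge 2$, \[ \mathrm{Comp}_{n+i}(\mathrm{Aut}\,\Pi) = \begin{cases} S_{\Pi^{(i)}}, & \text{if } \delta_n\notin\mathrm{Aut}\,\Pi \text{ and } \zeta_n\notin\mathrm{Aut}\,\Pi,\\ \langle S_{\Pi^{(i)}},\delta_{n+i}\rangle, & \text{if } \delta_n\in\mathrm{Aut}\,\Pi\text{ and }\zeta_n\notin\mathrm{Aut}\,\Pi,\\ D_{n+i}, & \text{if }\zeta_n\in\mathrm{Aut}\,\Pi.\end{cases} \]
   Context: $S_n$ is the symmetric group on $[n]=\{1,\dots,n\}$ (composition right to left); $\delta_n$ is $i\mapsto n+1-i$; $\zeta_n=(1\,2\,\cdots\,n)$; $D_n=\langle \zeta_n,\delta_n\rangle$. For a partition $\Pi$ of $[n]$, $\mathrm{Aut}\,\Pi=\{\pi\in S_n:\pi(B)\in\Pi\text{ for all }B\in\Pi\}$ and $S_\Pi=\{\pi\in S_n:\pi(B)=B\text{ for all }B\in\Pi\}$. Let $\widehat{\Pi}$ be the coarsest partition of $[n]$ into intervals refining $\Pi$, with blocks $[1]_{\widehat\Pi}\ni1$, $[n]_{\widehat\Pi}\ni n$; define partitions of $[n+1]$: $\widehat\Pi^{1}=\{B+1 : B\in\widehat\Pi,\,1\notin B\}\cup\{([1]_{\widehat\Pi}+1)\cup\{1\}\}$ and $\widehat\Pi^{n+1}=\{B: B\in\widehat\Pi,\, n\notin B\}\cup\{[n]_{\widehat\Pi}\cup\{n+1\}\}$;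 $\Pi'$ is their coarsest common refinement; $\Pi^{(1)}=\Pi'$, $\Pi^{(i+1)}=(\Pi^{(i)})'$. A permutation $\pi\in S_m$ involves $\tau\in S_n$ ($n\le m$) if there are indices $i_1<\dots<i_n$ with $\pi(i_j)<\pi(i_k)$ iff $\tau(j)<\tau(k)$ for all $j,k$; such $\tau$ is an $n$-pattern of $\pi$. For $S\subseteq S_n$, $\mathrm{Comp}_m(S)$ is the set of $\tau\in S_m$ all of whose $n$-patterns belong to $S$. -}

module Defs where

open import Level using (0ℓ)
open import Data.Nat using (ℕ; zero; suc; _+_)
open import Data.Fin using (Fin; zero; suc; _<_; _≤_; opposite)
open import Data.Maybe using (Maybe; just; nothing; maybe)
open import Data.Product using (Σ; ∃; _×_; _,_)
open import Data.Sum using (_⊎_)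
open import Data.Unit using (⊤)
open import Function using (_⇔_)
open import Relation.Binary.PropositionalEquality using (_≡_)
open import Data.Fin.Permutation using (Permutation′; _⟨$⟩ʳ_; _∘ₚ_; flip; id)

-- A partition of [n] (0-indexed as Fin n) is given by its "same block"
-- equivalence relation; the blocks are the equivalence classes.
BlockRel : ℕ → Set₁
BlockRel n = Fin n → Fin n → Set

image : ∀ {n} → BlockRel n → (Fin n → Fin n) → Fin n → Fin n → Set
image R f b x = ∃ λ y → R y b × f y ≡ x

AutF : ∀ {n} → BlockRel n → (Fin n → Fin n) → Set
AutF R f = ∀ b → ∃ λ c → ∀ x → (image R f b x ⇔ R x c)

Aut : ∀ {n} → BlockRel n → Permutation′ n → Set
Aut R π = AutF R (π ⟨$⟩ʳ_)

SP : ∀ {n} → BlockRel n → Permutation′ n → Set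
SP R π = ∀ b x → (image R (π ⟨$⟩ʳ_) b x ⇔ R x b)

δ : ∀ {n} → Fin n → Fin n
δ = opposite

dropLast : ∀ {n} → Fin (suc n) → Maybe (Fin n)
dropLast {zero} zero = nothing
dropLast {suc n} zero = just zero
dropLast {suc n} (suc i) = Data.Maybe.map suc (dropLast i)

ζ : ∀ {n} → Fin n → Fin n
ζ {suc m} i = maybe suc zero (dropLast i)

_≐_ : ∀ {n} → Permutation′ n → (Fin n → Fin n) → Set
π ≐ f = ∀ i → π ⟨$⟩ʳ i ≡ f i

data Gen {n} (G : Permutation′ n → Set) : Permutation′ n → Set where
  gen  : ∀ {π} → G π → Gen G π
  unit : Gen G id
  comp : ∀ {σ τ} → Gen G σ → Gen G τ → Gen G (σ ∘ₚ τ)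
  inv  : ∀ {σ} → Gen G σ → Gen G (flip σ)
  ext  : ∀ {σ τ} → (∀ i → σ ⟨$⟩ʳ i ≡ τ ⟨$⟩ʳ i) → Gen G σ → Gen G τ

SPδ : ∀ {n} → BlockRel n → Permutation′ n → Set
SPδ R = Gen (λ π → SP R π ⊎ π ≐ δ)

D : ∀ n → Permutation′ n → Set
D n = Gen (λ π → π ≐ ζ ⊎ π ≐ δ)

between : ∀ {n} → Fin n → Fin n → Fin n → Set
between i j k = (i ≤ k × k ≤ j) ⊎ (j ≤ k × k ≤ i)

-- Π̂ : coarsest interval partition refining Π (i ~ j iff the whole interval
-- between them lies in one block of Π)
hat : ∀ {n} → BlockRel n → BlockRel n
hat R i j = ∀ k → between i j k → R k i

inFirst : ∀ {n} → BlockRel n → Fin n → Set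
inFirst {suc m} R j = R j zero

inLast : ∀ {n} → BlockRel n → Fin n → Set
inLast {suc m} R j = R j (Data.Fin.fromℕ m)

hat1 : ∀ {n} → BlockRel n → BlockRel (suc n)
hat1 R zero zero = ⊤
hat1 R zero (suc j) = inFirst (hat R) j
hat1 R (suc i) zero = inFirst (hat R) i
hat1 R (suc i) (suc j) = hat R i j

hatLastAux : ∀ {n} → BlockRel n → Maybe (Fin n) → Maybe (Fin n) → Set
hatLastAux R nothing nothing = ⊤
hatLastAux R nothing (just j) = inLast (hat R) j
hatLastAux R (just i) nothing = inLast (hat R) i
hatLastAux R (just i) (just j) = hat R i j

hatN : ∀ {n} → BlockRel n → BlockRel (suc n)
hatN R i j = hatLastAux R (dropLast i) (dropLast j)

prime : ∀ {n} → BlockRel n → BlockRel (suc n)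
prime R i j = hat1 R i j × hatN R i j

iter : ∀ {n} (i : ℕ) → BlockRel n → BlockRel (i + n)
iter zero R = R
iter (suc i) R = prime (iter i R)

StrictInc : ∀ {n m} → (Fin n → Fin m) → Set
StrictInc ι = ∀ j k → j < k → ι j < ι k

Comp : ∀ {n} (m : ℕ) → (Permutation′ n → Set) → Permutation′ m → Set
Comp {n} m S τ = ∀ (ι : Fin n → Fin m) → StrictInc ι → (σ : Permutation′ n) →
  (∀ j k → ((σ ⟨$⟩ʳ j) < (σ ⟨$⟩ʳ k) ⇔ (τ ⟨$⟩ʳ ι j) < (τ ⟨$⟩ʳ ι k))) → S σ

{-# OPTIONS --safe #-}

-- Let τ ∈ Comp_{n+i}(Aut Π) and let u < v be the values of τ at two consecutive positions. Deleting
-- i-1 other entries together with either u or v gives two patterns of τ that differ by the cycle of an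
-- interval [u′, v′-1] of [n], so this cycle lies in Aut Π. If it and the cycle of the interval with
-- one endpoint moved inwards both lie in Aut Π, then so does a transposition, and since Π has no
-- singletons the whole interval lies in one block. As i ≥ 2, the deleted entries can be varied so
-- that this applies, unless [u′, v′-1] = [n] and ζ ∈ Aut Π. Hence, if ζ ∉ Aut Π, consecutive values
-- of τ never jump over a boundary of the interval partition Π^(i-1): crossing a boundary from C to
-- C+1, the sequence of values has to pass through C+1, and it does so once. So τ or τ∘δ maps every
-- block of Π^(i) onto itself. In the second case δ is a quotient of two elements of the group
-- Comp_{n+i}(Aut Π), so δ ∈ Aut Π. If ζ ∈ Aut Π, every c is a boundary, and consecutive values of τ
-- are cyclically adjacent, so τ is dihedral.
--
-- Nothing is assumed decidable about Π, so "not separated" is never obtained by contradiction: each step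
-- produces the relation between c and c+1 outright, from the given mates.
module Submission where

open import Defs
open import Data.Fin as Fin using (Fin; zero; suc; _<_; toℕ; fromℕ; fromℕ<; opposite; punchOut; _↑ʳ_)
open import Data.Fin.Permutation using (Permutation′; permutation; _⟨$⟩ʳ_; _⟨$⟩ˡ_; inverseˡ; inverseʳ; _∘ₚ_; flip; id; _≈_; reverse)
open import Data.Fin.Properties using (toℕ-injective; toℕ<n; toℕ-fromℕ; toℕ-fromℕ<; fromℕ<-toℕ; fromℕ<-cong; toℕ-↑ʳ; opposite-prop; opposite-involutive; _≟_; _<?_; <-cmp; any?; punchOut-injective; injective⇒≤)
open import Data.Fin.Subset using (Subset; ∣_∣; _∈_)
open import Data.Fin.Subset.Properties using (p⊂q⇒∣p∣<∣q∣; ∣⊤∣≡n; ∈⊤)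
open import Data.Maybe using (Maybe; just; nothing)
open import Data.Nat as ℕ using (ℕ; zero; suc; _+_; _≤_; z≤n; s≤s)
import Data.Nat.Properties as ℕ
open import Data.Product using (∃; _×_; _,_; proj₁; proj₂)
open import Data.Sum using (_⊎_; inj₁; inj₂)
open import Data.Unit using (tt)
open import Data.Vec using (tabulate)
open import Data.Vec.Properties using (lookup⇒[]=; []=⇒lookup; lookup∘tabulate)
open import Function using (_⇔_; mk⇔; Equivalence; _∘_)
open import Relation.Binary.Definitions using (tri<; tri≈; tri>)
open import Relation.Binary.PropositionalEquality using (_≡_; _≢_; refl; sym; trans; cong; subst; subst₂; module ≡-Reasoning)
open import Relation.Binary.Structures using (IsEquivalence)
open import Relation.Nullary using (¬_; Dec; yes; no; does)
open import Relation.Nullary.Decidable using (dec-true; dec-false; decidable-stable; _×-dec_; _⊎-dec_)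
open import Relation.Nullary.Negation using (contradiction)

open Equivalence using (to; from)

-- Patterns and the group Comp

⟨$⟩ʳ-injective : ∀ {n} (π : Permutation′ n) {x y} → π ⟨$⟩ʳ x ≡ π ⟨$⟩ʳ y → x ≡ y
⟨$⟩ʳ-injective π eq = trans (sym (inverseˡ π)) (trans (cong (π ⟨$⟩ˡ_) eq) (inverseˡ π))

strictInc⇒≤ : ∀ {n m} {f : Fin n → Fin m} → StrictInc f → ∀ x → toℕ x ℕ.≤ toℕ (f x)
strictInc⇒≤ {n} {m} {f} inc x = go (toℕ x) x refl
  where
  go : ∀ k x → toℕ x ≡ k → k ℕ.≤ toℕ (f x)
  go zero x _ = z≤n
  go (suc k) x x≡ = ℕ.<-≤-trans (s≤s (go k y (toℕ-fromℕ< k<n))) (inc y x y<x)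
    where
    k<n : k ℕ.< n
    k<n = ℕ.<-trans (ℕ.n<1+n k) (subst (ℕ._< n) x≡ (toℕ<n x))
    y = fromℕ< k<n
    y<x : y < x
    y<x = subst₂ ℕ._<_ (sym (toℕ-fromℕ< k<n)) (sym x≡) (ℕ.n<1+n k)

-- Subtraction-free form of f x - x ≤ m - n: the entries after `x` need room above `f x`. The
-- induction runs on their number.
strictInc⇒+≤ : ∀ {n m} {f : Fin n → Fin m} → StrictInc f → ∀ x → toℕ (f x) + n ℕ.≤ m + toℕ x
strictInc⇒+≤ {n} {m} {f} inc x with ℕ.m≤n⇒∃[o]m+o≡n (toℕ<n x)
... | k , eq = begin
  toℕ (f x) + n                     ≡⟨ cong (toℕ (f x) +_) (trans (sym eq) (trans (cong suc (ℕ.+-comm (toℕ x) k)) refl)) ⟩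
  toℕ (f x) + (suc k + toℕ x)       ≡⟨ ℕ.+-assoc (toℕ (f x)) (suc k) (toℕ x) ⟨
  toℕ (f x) + suc k + toℕ x         ≤⟨ ℕ.+-monoˡ-≤ (toℕ x) (go k x (trans (ℕ.+-suc (toℕ x) k) eq)) ⟩
  m + toℕ x                         ∎
  where
  open ℕ.≤-Reasoning
  go : ∀ k x → toℕ x + suc k ≡ n → toℕ (f x) + suc k ℕ.≤ m
  go zero x _ = subst (ℕ._≤ m) (ℕ.+-comm 1 (toℕ (f x))) (toℕ<n (f x))
  go (suc k) x x≡ = ℕ.≤-trans (ℕ.≤-trans (ℕ.≤-reflexive (ℕ.+-suc (toℕ (f x)) (suc k))) (ℕ.+-monoˡ-≤ (suc k) (inc x y x<y))) (go k y y≡)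
    where
    x+<n : suc (toℕ x) ℕ.< n
    x+<n = subst (suc (suc (toℕ x)) ℕ.≤_) (trans (cong suc (sym (ℕ.+-suc (toℕ x) k))) (trans (sym (ℕ.+-suc (toℕ x) (suc k))) x≡)) (s≤s (s≤s (ℕ.m≤m+n (toℕ x) k)))
    y = fromℕ< x+<n
    x<y : x < y
    x<y = ℕ.≤-reflexive (sym (toℕ-fromℕ< x+<n))
    y≡ : toℕ y + suc k ≡ n
    y≡ = trans (cong (_+ suc k) (toℕ-fromℕ< x+<n)) (trans (sym (ℕ.+-suc (toℕ x) (suc k))) x≡)

strictInc-endo : ∀ {n} {f : Fin n → Fin n} → StrictInc f → ∀ x → f x ≡ x
strictInc-endo {n} {f} inc x = toℕ-injective (ℕ.≤-antisym
  (ℕ.+-cancelʳ-≤ n _ _ (subst (toℕ (f x) + n ℕ.≤_) (ℕ.+-comm n (toℕ x)) (strictInc⇒+≤ inc x)))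
  (strictInc⇒≤ inc x))

OrderIso : ∀ {n m l} → (Fin n → Fin m) → (Fin n → Fin l) → Set
OrderIso f g = ∀ j k → (f j < f k ⇔ g j < g k)

-- The composite f ∘ π⁻¹ is a strictly increasing self-map of `Fin n`, hence the identity.
orderIso-unique : ∀ {n} {f : Fin n → Fin n} (π : Permutation′ n) → OrderIso f (π ⟨$⟩ʳ_) → ∀ x → f x ≡ π ⟨$⟩ʳ x
orderIso-unique {f = f} π iso x =
  trans (cong f (sym (inverseˡ π))) (strictInc-endo {f = f ∘ (π ⟨$⟩ˡ_)} inc (π ⟨$⟩ʳ x))
  where
  inc : StrictInc (f ∘ (π ⟨$⟩ˡ_))
  inc j k j<k = from (iso _ _) (subst₂ _<_ (sym (inverseʳ π)) (sym (inverseʳ π)) j<k)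

strictInc-reflects : ∀ {n m} {f : Fin n → Fin m} → StrictInc f → ∀ j k → f j < f k → j < k
strictInc-reflects {f = f} inc j k fj<fk with <-cmp j k
... | tri< j<k _ _ = j<k
... | tri≈ _ refl _ = contradiction refl (ℕ.<⇒≢ fj<fk)
... | tri> _ _ k<j = contradiction (inc k j k<j) (ℕ.<-asym fj<fk)

strictInc-injective : ∀ {n m} {f : Fin n → Fin m} → StrictInc f → ∀ {j k} → f j ≡ f k → j ≡ k
strictInc-injective {f = f} inc {j} {k} eq with <-cmp j k
... | tri< j<k _ _ = contradiction (cong toℕ eq) (ℕ.<⇒≢ (inc j k j<k))
... | tri≈ _ j≡k _ = j≡k
... | tri> _ _ k<j = contradiction (cong toℕ (sym eq)) (ℕ.<⇒≢ (inc k j k<j))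

-- Surjectivity is the pigeonhole principle: a missed value could be punched out, giving an
-- injection of `Fin (suc n)` into `Fin n`.
injective⇒permutation : ∀ {n} (f : Fin n → Fin n) → (∀ {x y} → f x ≡ f y → x ≡ y) →
  ∃ λ (π : Permutation′ n) → ∀ x → π ⟨$⟩ʳ x ≡ f x
injective⇒permutation {n} f inj = permutation f (proj₁ ∘ onto) (proj₂ ∘ onto) (λ x → inj (proj₂ (onto (f x)))) , λ _ → refl
  where
  noMiss : ∀ {n} {f : Fin n → Fin n} → (∀ {x y} → f x ≡ f y → x ≡ y) → ∀ y → ¬ (∀ x → y ≢ f x)
  noMiss {suc n} inj y miss = ℕ.1+n≰n (injective⇒≤ {f = λ x → punchOut (miss x)} λ {a} {b} eq → inj (punchOut-injective (miss a) (miss b) eq))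

  onto : ∀ y → ∃ λ x → f x ≡ y
  onto y with any? (λ x → f x ≟ y)
  ... | yes p = p
  ... | no ¬p = contradiction (λ x eq → ¬p (x , sym eq)) (noMiss inj y)

-- This `σ` is the pattern of the word `κ`: the rank of `j` counts the entries below `κ j`.
standardise : ∀ {n m} (κ : Fin n → Fin m) → (∀ {x y} → κ x ≡ κ y → x ≡ y) →
  ∃ λ (σ : Permutation′ n) → OrderIso (σ ⟨$⟩ʳ_) κ
standardise {n} {m} κ inj = π , λ j k → mk⇔ (reflect j k ∘ subst₂ _<_ (π≡ j) (π≡ k)) (subst₂ _<_ (sym (π≡ j)) (sym (π≡ k)) ∘ rank-mono j k)
  where
  below : Fin n → Subset n
  below j = tabulate (λ k → does (κ k <? κ j))

  ∈⁺ : ∀ {j k} → κ k < κ j → k ∈ below j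
  ∈⁺ {j} {k} k<j = lookup⇒[]= k (below j) (trans (lookup∘tabulate _ k) (dec-true (κ k <? κ j) k<j))

  ∈⁻ : ∀ {j k} → k ∈ below j → κ k < κ j
  ∈⁻ {j} {k} k∈ = decidable-stable (κ k <? κ j) λ k≮j →
    contradiction (trans (sym (dec-false (κ k <? κ j) k≮j)) (trans (sym (lookup∘tabulate _ k)) ([]=⇒lookup k∈))) λ ()

  rank< : ∀ j → ∣ below j ∣ ℕ.< n
  rank< j = subst (∣ below j ∣ ℕ.<_) (∣⊤∣≡n n) (p⊂q⇒∣p∣<∣q∣ ((λ _ → ∈⊤) , j , ∈⊤ , λ j∈ → ℕ.<-irrefl refl (∈⁻ {j} j∈)))

  rank : Fin n → Fin n
  rank j = fromℕ< (rank< j)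

  rank-mono : ∀ j k → κ j < κ k → rank j < rank k
  rank-mono j k j<k = subst₂ ℕ._<_ (sym (toℕ-fromℕ< (rank< j))) (sym (toℕ-fromℕ< (rank< k)))
    (p⊂q⇒∣p∣<∣q∣ ((λ x∈ → ∈⁺ (ℕ.<-trans (∈⁻ {j} x∈) j<k)) , j , ∈⁺ j<k , λ j∈ → ℕ.<-irrefl refl (∈⁻ {j} j∈)))

  reflect : ∀ j k → rank j < rank k → κ j < κ k
  reflect j k r with <-cmp (κ j) (κ k)
  ... | tri< j<k _ _ = j<k
  ... | tri≈ _ j≡k _ = contradiction (cong (toℕ ∘ rank) (inj j≡k)) (ℕ.<⇒≢ r)
  ... | tri> _ _ k<j = contradiction (rank-mono k j k<j) (ℕ.<-asym r)

  rank-injective : ∀ {x y} → rank x ≡ rank y → x ≡ y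
  rank-injective {x} {y} eq with <-cmp (κ x) (κ y)
  ... | tri< x<y _ _ = contradiction (cong toℕ eq) (ℕ.<⇒≢ (rank-mono x y x<y))
  ... | tri≈ _ x≡y _ = inj x≡y
  ... | tri> _ _ y<x = contradiction (cong toℕ (sym eq)) (ℕ.<⇒≢ (rank-mono y x y<x))

  π = proj₁ (injective⇒permutation rank rank-injective)
  π≡ = proj₂ (injective⇒permutation rank rank-injective)

module _ {n m : ℕ} {S : Permutation′ n → Set} where

  comp-ext : ∀ {σ τ : Permutation′ m} → σ ≈ τ → Comp m S σ → Comp m S τ
  comp-ext σ≈τ c ι inc ρ iso = c ι inc ρ λ j k →
    subst₂ (λ a b → (ρ ⟨$⟩ʳ j) < (ρ ⟨$⟩ʳ k) ⇔ a < b) (sym (σ≈τ (ι j))) (sym (σ≈τ (ι k))) (iso j k)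

  -- When `τ` is read at `ι`, these are the positions at which a permutation applied after `τ` has
  -- to be read.
  sortedImage : (τ : Permutation′ m) (ι : Fin n → Fin m) (σ : Permutation′ n) →
    OrderIso (σ ⟨$⟩ʳ_) ((τ ⟨$⟩ʳ_) ∘ ι) → StrictInc (λ j → τ ⟨$⟩ʳ ι (σ ⟨$⟩ˡ j))
  sortedImage τ ι σ iso j k j<k = to (iso _ _) (subst₂ _<_ (sym (inverseʳ σ)) (sym (inverseʳ σ)) j<k)

  -- The pattern `σ` of τ⁻¹ at `ι` is the inverse of the pattern of `τ` at the sorted positions τ⁻¹
  -- ι.
  comp-flip : (∀ σ → S (flip σ) → S σ) → ∀ {τ : Permutation′ m} → Comp m S τ → Comp m S (flip τ)
  comp-flip closed {τ} c ι inc σ iso = closed σ (c _ (sortedImage (flip τ) ι σ iso) (flip σ) λ j k →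
    mk⇔ (subst₂ _<_ (sym (inverseʳ τ)) (sym (inverseʳ τ)) ∘ inc _ _)
        (strictInc-reflects inc _ _ ∘ subst₂ _<_ (inverseʳ τ) (inverseʳ τ)))

  -- The pattern of the product at `ι` factors into the pattern `σ′` of `σ` at `ι`, followed by the
  -- pattern of `τ` at the sorted values that `σ` takes there.
  comp-∘ : (∀ {σ τ ρ} → S σ → S τ → σ ∘ₚ τ ≈ ρ → S ρ) →
    ∀ {σ τ : Permutation′ m} → Comp m S σ → Comp m S τ → Comp m S (σ ∘ₚ τ)
  comp-∘ closed {σ} {τ} cσ cτ ι inc ρ iso with standardise ((σ ⟨$⟩ʳ_) ∘ ι) (strictInc-injective inc ∘ ⟨$⟩ʳ-injective σ)
  ... | σ′ , iso′ = closed {σ = σ′} {τ = flip σ′ ∘ₚ ρ} (cσ ι inc σ′ iso′)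
    (cτ _ (sortedImage σ ι σ′ iso′) (flip σ′ ∘ₚ ρ) λ j k → iso _ _)
    (λ i → cong (ρ ⟨$⟩ʳ_) (inverseˡ σ′))

  comp-id : (∀ {ρ} → id ≈ ρ → S ρ) → Comp m S id
  comp-id closed ι inc σ iso = closed λ i → sym (orderIso-unique id (λ j k → mk⇔ (strictInc-reflects inc j k ∘ to (iso j k)) (from (iso j k) ∘ inc j k)) i)

-- For a bijection this is the same as permuting the blocks, and it composes and inverts without any
-- choice of target blocks.
Pres : ∀ {n} → BlockRel n → (Fin n → Fin n) → Set
Pres R f = ∀ x y → (R x y ⇔ R (f x) (f y))

module _ {n : ℕ} {R : BlockRel n} (eqv : IsEquivalence R) where
  private module E = IsEquivalence eqv

  autF⇒pres : ∀ {f} → (∀ {x y} → f x ≡ f y → x ≡ y) → AutF R f → Pres R f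
  autF⇒pres {f} inj aut x y with aut y
  ... | c , h = mk⇔ (λ r → E.trans (to (h (f x)) (x , r , refl)) (E.sym fy))
                    (λ r → pull (from (h (f x)) (E.trans r fy)))
    where
    fy : R (f y) c
    fy = to (h (f y)) (y , E.refl , refl)
    pull : image R f y (f x) → R x y
    pull (x′ , r , eq) = subst (λ z → R z y) (inj eq) r

  pres⇒autF : ∀ {f} (g : Fin n → Fin n) → (∀ x → f (g x) ≡ x) → Pres R f → AutF R f
  pres⇒autF {f} g fg pres b = f b , λ x → mk⇔
    (λ { (y , r , refl) → to (pres y b) r })
    (λ r → g x , from (pres (g x) b) (subst (λ z → R z (f b)) (sym (fg x)) r) , fg x)

  aut⇒pres : ∀ π → Aut R π → Pres R (π ⟨$⟩ʳ_)
  aut⇒pres π = autF⇒pres (⟨$⟩ʳ-injective π)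

  pres⇒aut : ∀ π → Pres R (π ⟨$⟩ʳ_) → Aut R π
  pres⇒aut π = pres⇒autF (π ⟨$⟩ˡ_) (λ _ → inverseʳ π)

  pres-ext : ∀ {f g} → (∀ x → f x ≡ g x) → Pres R f → Pres R g
  pres-ext f≡g pres x y = subst₂ (λ a b → R x y ⇔ R a b) (f≡g x) (f≡g y) (pres x y)

  pres-flip : ∀ π → Pres R (π ⟨$⟩ˡ_) → Pres R (π ⟨$⟩ʳ_)
  pres-flip π pres x y = mk⇔
    (λ r → from (pres _ _) (subst₂ R (sym (inverseˡ π)) (sym (inverseˡ π)) r))
    (λ r → subst₂ R (inverseˡ π) (inverseˡ π) (to (pres _ _) r))

  autF-ext : ∀ {f g} → (∀ x → f x ≡ g x) → AutF R f → AutF R g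
  autF-ext f≡g aut b = proj₁ (aut b) , λ x → mk⇔
    (λ { (y , r , eq) → to (proj₂ (aut b) x) (y , r , trans (f≡g y) eq) })
    (λ r → let (y , r′ , eq) = from (proj₂ (aut b) x) r in y , r′ , trans (sym (f≡g y)) eq)

  aut-flip : ∀ σ → Aut R (flip σ) → Aut R σ
  aut-flip σ a = pres⇒aut σ (pres-flip σ (aut⇒pres (flip σ) a))

  aut-∘ : ∀ {σ τ ρ} → Aut R σ → Aut R τ → σ ∘ₚ τ ≈ ρ → Aut R ρ
  aut-∘ {σ} {τ} {ρ} a b eq = pres⇒aut ρ (pres-ext eq λ x y →
    mk⇔ (to (aut⇒pres τ b _ _) ∘ to (aut⇒pres σ a _ _)) (from (aut⇒pres σ a _ _) ∘ from (aut⇒pres τ b _ _)))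

  aut-id : ∀ {ρ} → id ≈ ρ → Aut R ρ
  aut-id {ρ} eq = pres⇒aut ρ (pres-ext eq λ x y → mk⇔ (λ r → r) (λ r → r))

-- Interval cycles obtained from consecutive entries

Adjacent : ℕ → ℕ → Set
Adjacent a b = a ≡ suc b ⊎ b ≡ suc a

-- Nothing lies strictly between adjacent values, so exchanging `a` for `b` affects no comparison
-- with a third value `w`.
adjacent-< : ∀ {a b w} → Adjacent a b → w ≢ a → w ≢ b → a ℕ.< w → b ℕ.< w
adjacent-< (inj₁ refl) _ _ a<w = ℕ.<-trans (ℕ.n<1+n _) a<w
adjacent-< (inj₂ refl) _ w≢b a<w = ℕ.≤∧≢⇒< a<w (w≢b ∘ sym)

adjacent-> : ∀ {a b w} → Adjacent a b → w ≢ a → w ≢ b → w ℕ.< a → w ℕ.< b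
adjacent-> (inj₁ refl) _ w≢b (s≤s w≤b) = ℕ.≤∧≢⇒< w≤b w≢b
adjacent-> (inj₂ refl) _ _ w<a = ℕ.<-trans w<a (ℕ.n<1+n _)

adjacent-sym : ∀ {a b} → Adjacent a b → Adjacent b a
adjacent-sym (inj₁ p) = inj₂ p
adjacent-sym (inj₂ p) = inj₁ p

abstract
  -- For p ≤ q this is the cycle (p p+1 ⋯ q). It lives on ℕ so that its endpoints can vary freely.
  cyc : ℕ → ℕ → ℕ → ℕ
  cyc p q x with x ℕ.<? p
  ... | yes _ = x
  ... | no _ with ℕ.<-cmp x q
  ...   | tri< _ _ _ = suc x
  ...   | tri≈ _ _ _ = p
  ...   | tri> _ _ _ = x

  cyc-below : ∀ {p q x} → x ℕ.< p → cyc p q x ≡ x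
  cyc-below {p} {q} {x} x<p with x ℕ.<? p
  ... | yes _ = refl
  ... | no x≮p = contradiction x<p x≮p

  cyc-mid : ∀ {p q x} → p ℕ.≤ x → x ℕ.< q → cyc p q x ≡ suc x
  cyc-mid {p} {q} {x} p≤x x<q with x ℕ.<? p
  ... | yes x<p = contradiction p≤x (ℕ.<⇒≱ x<p)
  ... | no _ with ℕ.<-cmp x q
  ...   | tri< _ _ _ = refl
  ...   | tri≈ x≮q _ _ = contradiction x<q x≮q
  ...   | tri> x≮q _ _ = contradiction x<q x≮q

  cyc-end : ∀ {p q} → p ℕ.≤ q → cyc p q q ≡ p
  cyc-end {p} {q} p≤q with q ℕ.<? p
  ... | yes q<p = contradiction p≤q (ℕ.<⇒≱ q<p)
  ... | no _ with ℕ.<-cmp q q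
  ...   | tri< _ q≢q _ = contradiction refl q≢q
  ...   | tri≈ _ _ _ = refl
  ...   | tri> _ q≢q _ = contradiction refl q≢q

  cyc-above : ∀ {p q x} → q ℕ.< x → cyc p q x ≡ x
  cyc-above {p} {q} {x} q<x with x ℕ.<? p
  ... | yes _ = refl
  ... | no _ with ℕ.<-cmp x q
  ...   | tri< _ _ q≮x = contradiction q<x q≮x
  ...   | tri≈ _ _ q≮x = contradiction q<x q≮x
  ...   | tri> _ _ _ = refl

  data Position (p q x : ℕ) : Set where
    below : x ℕ.< p → Position p q x
    mid   : p ℕ.≤ x → x ℕ.< q → Position p q x
    end   : x ≡ q → Position p q x
    above : q ℕ.< x → Position p q x

  position : ∀ p q x → Position p q x
  position p q x with x ℕ.<? p
  ... | yes x<p = below x<p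
  ... | no x≮p with ℕ.<-cmp x q
  ...   | tri< x<q _ _ = mid (ℕ.≮⇒≥ x≮p) x<q
  ...   | tri≈ _ x≡q _ = end x≡q
  ...   | tri> _ _ q<x = above q<x

  cyc-< : ∀ {p q n x} → p ℕ.≤ q → q ℕ.< n → x ℕ.< n → cyc p q x ℕ.< n
  cyc-< {p} {q} {n} {x} p≤q q<n x<n with position p q x
  ... | below x<p = subst (ℕ._< n) (sym (cyc-below x<p)) x<n
  ... | mid p≤x x<q = subst (ℕ._< n) (sym (cyc-mid p≤x x<q)) (ℕ.≤-<-trans x<q q<n)
  ... | end refl = subst (ℕ._< n) (sym (cyc-end {p} p≤q)) (ℕ.≤-<-trans p≤q q<n)
  ... | above q<x = subst (ℕ._< n) (sym (cyc-above {p} q<x)) x<n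

  -- The increasing enumeration of ℕ without `w`.
  skip : ℕ → ℕ → ℕ
  skip w x with x ℕ.<? w
  ... | yes _ = x
  ... | no _ = suc x

  skip-< : ∀ {w x} → x ℕ.< w → skip w x ≡ x
  skip-< {w} {x} x<w with x ℕ.<? w
  ... | yes _ = refl
  ... | no x≮w = contradiction x<w x≮w

  skip-≥ : ∀ {w x} → w ℕ.≤ x → skip w x ≡ suc x
  skip-≥ {w} {x} w≤x with x ℕ.<? w
  ... | yes x<w = contradiction w≤x (ℕ.<⇒≱ x<w)
  ... | no _ = refl

  skip-≢ : ∀ w x → skip w x ≢ w
  skip-≢ w x eq with x ℕ.<? w
  ... | yes x<w = ℕ.<⇒≢ x<w eq
  ... | no x≮w = x≮w (ℕ.≤-reflexive eq)

  skip-≤ : ∀ w {n x} → x ℕ.< n → skip w x ℕ.≤ n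
  skip-≤ w {n} {x} x<n with x ℕ.<? w
  ... | yes _ = ℕ.<⇒≤ x<n
  ... | no _ = x<n

  skip-mono : ∀ w {x y} → x ℕ.< y → skip w x ℕ.< skip w y
  skip-mono w {x} {y} x<y with x ℕ.<? w | y ℕ.<? w
  ... | yes _ | yes _ = x<y
  ... | yes _ | no _ = ℕ.m≤n⇒m≤1+n x<y
  ... | no x≮w | yes y<w = contradiction (ℕ.<-trans x<y y<w) x≮w
  ... | no _ | no _ = s≤s x<y

  -- Place `x` of the enumeration omitting p corresponds to place `cyc p q x` of the one omitting q
  -- + 1. At x = q the former has q + 1 and the latter has p.
  skip-cyc : ∀ {p q} x → p ℕ.≤ q → x ≢ q → skip (suc q) (cyc p q x) ≡ skip p x
  skip-cyc {p} {q} x p≤q x≢q with position p q x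
  ... | below x<p rewrite cyc-below {q = q} x<p = trans (skip-< (ℕ.m≤n⇒m≤1+n (ℕ.<-≤-trans x<p p≤q))) (sym (skip-< x<p))
  ... | mid p≤x x<q rewrite cyc-mid p≤x x<q = trans (skip-< (s≤s x<q)) (sym (skip-≥ p≤x))
  ... | end x≡q = contradiction x≡q x≢q
  ... | above q<x rewrite cyc-above {p} q<x = trans (skip-≥ q<x) (sym (skip-≥ (ℕ.≤-trans p≤q (ℕ.<⇒≤ q<x))))

  -- The increasing enumeration of what remains after deleting the e lowest indices
  -- and the d indices right after u + e.
  spread : (u e d : ℕ) → ℕ → ℕ
  spread u e d x with x ℕ.≤? u
  ... | yes _ = x + e
  ... | no _ = x + (e + d)

  spread-≤ : ∀ {u x} e d → x ℕ.≤ u → spread u e d x ≡ x + e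
  spread-≤ {u} {x} e d x≤u with x ℕ.≤? u
  ... | yes _ = refl
  ... | no x≰u = contradiction x≤u x≰u

  spread-> : ∀ {u x} e d → u ℕ.< x → spread u e d x ≡ x + (e + d)
  spread-> {u} {x} e d u<x with x ℕ.≤? u
  ... | yes x≤u = contradiction u<x (ℕ.≤⇒≯ x≤u)
  ... | no _ = refl

  spread-mono : ∀ u e d {x y} → x ℕ.< y → spread u e d x ℕ.< spread u e d y
  spread-mono u e d {x} {y} x<y with x ℕ.≤? u | y ℕ.≤? u
  ... | yes _ | yes _ = ℕ.+-monoˡ-< e x<y
  ... | yes _ | no _ = ℕ.+-mono-<-≤ x<y (ℕ.m≤m+n e d)
  ... | no x≰u | yes y≤u = contradiction (ℕ.≤-trans (ℕ.<⇒≤ x<y) y≤u) x≰u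
  ... | no _ | no _ = ℕ.+-monoˡ-< (e + d) x<y

  spread-bound : ∀ u e d x → spread u e d x ℕ.≤ x + (e + d)
  spread-bound u e d x with x ℕ.≤? u
  ... | yes _ = ℕ.+-monoʳ-≤ x (ℕ.m≤m+n e d)
  ... | no _ = ℕ.≤-refl

strictMono-injective : ∀ {f : ℕ → ℕ} → (∀ {x y} → x ℕ.< y → f x ℕ.< f y) → ∀ {x y} → f x ≡ f y → x ≡ y
strictMono-injective mono {x} {y} eq with ℕ.<-cmp x y
... | tri< x<y _ _ = contradiction eq (ℕ.<⇒≢ (mono x<y))
... | tri≈ _ x≡y _ = x≡y
... | tri> _ _ y<x = contradiction (sym eq) (ℕ.<⇒≢ (mono y<x))

module _ {n I : ℕ} {R : BlockRel n} (eqv : IsEquivalence R) where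

  -- The pattern of θ avoiding u and the one avoiding v, with otherwise the same indices, differ by this cycle.
  adjacent⇒cyc-pres : (θ : Permutation′ (suc I + n)) → Comp (suc I + n) (Aut R) θ →
    ∀ {p q e d} (p≤q : p ℕ.≤ q) (q<n : q ℕ.< n) → e + d ℕ.≤ I →
    ∀ {u v} → toℕ u ≡ p + e → toℕ v ≡ suc q + (e + d) →
    Adjacent (toℕ (θ ⟨$⟩ʳ u)) (toℕ (θ ⟨$⟩ʳ v)) →
    Pres R (λ x → fromℕ< (cyc-< p≤q q<n (toℕ<n x)))
  adjacent⇒cyc-pres θ c {p} {q} {e} {d} p≤q q<n e+d≤I {u} {v} u≡ v≡ adj x y =
    mk⇔ (λ r → from (aut⇒pres eqv ρ₂ aut₂ _ _) (subst₂ R (sym (ρ≡ x)) (sym (ρ≡ y)) (to (aut⇒pres eqv ρ₁ aut₁ x y) r)))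
        (λ r → from (aut⇒pres eqv ρ₁ aut₁ x y) (subst₂ R (ρ≡ x) (ρ≡ y) (to (aut⇒pres eqv ρ₂ aut₂ _ _) r)))
    where
    K : ℕ → ℕ
    K = spread p e d

    g : Fin n → Fin n
    g x = fromℕ< (cyc-< p≤q q<n (toℕ<n x))

    κ< : ∀ w (x : Fin n) → K (skip w (toℕ x)) ℕ.< suc I + n
    κ< w x = s≤s (ℕ.≤-trans (spread-bound p e d _) (subst (skip w (toℕ x) + (e + d) ℕ.≤_) (ℕ.+-comm n I)
      (ℕ.+-mono-≤ (skip-≤ w (toℕ<n x)) e+d≤I)))

    -- `w = p` omits `u` and `w = suc q` omits `v`. Apart from these two and the e + d indices
    -- skipped by `K`, the I - (e + d) highest indices are left out.
    κ : ℕ → Fin n → Fin (suc I + n)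
    κ w x = fromℕ< (κ< w x)

    κ-inc : ∀ w → StrictInc (κ w)
    κ-inc w j k j<k = subst₂ ℕ._<_ (sym (toℕ-fromℕ< (κ< w j))) (sym (toℕ-fromℕ< (κ< w k))) (spread-mono p e d (skip-mono w j<k))

    std : ∀ w → ∃ λ (σ : Permutation′ n) → OrderIso (σ ⟨$⟩ʳ_) ((θ ⟨$⟩ʳ_) ∘ κ w)
    std w = standardise _ (strictInc-injective (κ-inc w) ∘ ⟨$⟩ʳ-injective θ)

    ρ₁ = proj₁ (std p)
    ρ₂ = proj₁ (std (suc q))
    aut₁ = c (κ p) (κ-inc p) ρ₁ (proj₂ (std p))
    aut₂ = c (κ (suc q)) (κ-inc (suc q)) ρ₂ (proj₂ (std (suc q)))

    a b : Fin n → ℕ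
    a x = toℕ (θ ⟨$⟩ʳ κ p x)
    b x = toℕ (θ ⟨$⟩ʳ κ (suc q) (g x))

    tu = toℕ (θ ⟨$⟩ʳ u)
    tv = toℕ (θ ⟨$⟩ʳ v)

    K-p : K p ≡ toℕ u
    K-p = trans (spread-≤ e d ℕ.≤-refl) (sym u≡)

    K-q : K (suc q) ≡ toℕ v
    K-q = trans (spread-> e d (s≤s p≤q)) (sym v≡)

    θ-miss : ∀ w w′ (z : Fin n) → K w ≡ toℕ w′ → skip w (toℕ z) ≢ w → toℕ (θ ⟨$⟩ʳ κ w z) ≢ toℕ (θ ⟨$⟩ʳ w′)
    θ-miss w w′ z Kw miss eq = miss (strictMono-injective (spread-mono p e d)
      (trans (sym (toℕ-fromℕ< (κ< w z))) (trans (cong toℕ (⟨$⟩ʳ-injective θ (toℕ-injective eq))) (sym Kw))))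

    -- Along `g` the two words agree, except that in place q one has the value at `v` and the other
    -- the value at `u`. The shared entries avoid both values, and as these are consecutive no
    -- comparison changes.
    ab : ∀ x → (a x ≡ b x × a x ≢ tu × a x ≢ tv) ⊎ (a x ≡ tv × b x ≡ tu)
    ab x with toℕ x ℕ.≟ q
    ... | no x≢q = inj₁ (a≡b , θ-miss p u x K-p (skip-≢ p (toℕ x)) , λ eq → θ-miss (suc q) v (g x) K-q (skip-≢ (suc q) _) (trans (sym a≡b) eq))
      where
      a≡b : a x ≡ b x
      a≡b = cong (toℕ ∘ (θ ⟨$⟩ʳ_)) (fromℕ<-cong _ _ (cong K (trans (sym (skip-cyc (toℕ x) p≤q x≢q))
        (cong (skip (suc q)) (sym (toℕ-fromℕ< (cyc-< p≤q q<n (toℕ<n x))))))) (κ< p x) (κ< (suc q) (g x)))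
    ... | yes x≡q = inj₂
      ( cong (toℕ ∘ (θ ⟨$⟩ʳ_)) (toℕ-injective (trans (toℕ-fromℕ< (κ< p x)) (trans (cong K (trans (cong (skip p) x≡q) (skip-≥ p≤q))) K-q)))
      , cong (toℕ ∘ (θ ⟨$⟩ʳ_)) (toℕ-injective (trans (toℕ-fromℕ< (κ< (suc q) (g x))) (trans (cong K gx) K-p))))
      where
      gx : skip (suc q) (toℕ (g x)) ≡ p
      gx = trans (cong (skip (suc q)) (trans (toℕ-fromℕ< (cyc-< p≤q q<n (toℕ<n x))) (trans (cong (cyc p q) x≡q) (cyc-end p≤q)))) (skip-< (s≤s p≤q))

    ab-iso : ∀ x y → (a x ℕ.< a y ⇔ b x ℕ.< b y)
    ab-iso x y with ab x | ab y
    ... | inj₁ (ex , _) | inj₁ (ey , _) = mk⇔ (subst₂ ℕ._<_ ex ey) (subst₂ ℕ._<_ (sym ex) (sym ey))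
    ... | inj₁ (ex , xu , xv) | inj₂ (ay , by) rewrite sym ex | ay | by = mk⇔ (adjacent-> (adjacent-sym adj) xv xu) (adjacent-> adj xu xv)
    ... | inj₂ (ax , bx) | inj₁ (ey , yu , yv) rewrite sym ey | ax | bx = mk⇔ (adjacent-< (adjacent-sym adj) yv yu) (adjacent-< adj yu yv)
    ... | inj₂ (ax , bx) | inj₂ (ay , by) rewrite ax | bx | ay | by = mk⇔ (λ l → contradiction l (ℕ.<-irrefl refl)) (λ l → contradiction l (ℕ.<-irrefl refl))

    -- The words are ordered alike along `g`, so `g` is the quotient ρ₂⁻¹ ρ₁ of two automorphisms.
    ρ≡ : ∀ x → ρ₂ ⟨$⟩ʳ g x ≡ ρ₁ ⟨$⟩ʳ x
    ρ≡ = orderIso-unique ρ₁ λ j k →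
      mk⇔ (from (proj₂ (std p) j k) ∘ from (ab-iso j k) ∘ to (proj₂ (std (suc q)) (g j) (g k)))
          (from (proj₂ (std (suc q)) (g j) (g k)) ∘ to (ab-iso j k) ∘ to (proj₂ (std p) j k))

-- The bounds are packed into the proof, so that arithmetic on indices needs no coercions between
-- `Fin n` and ℕ.
data ℕRel {n : ℕ} (R : BlockRel n) (x y : ℕ) : Set where
  rel : (x<n : x ℕ.< n) (y<n : y ℕ.< n) → R (fromℕ< x<n) (fromℕ< y<n) → ℕRel R x y

PresN : ∀ {n} → BlockRel n → (ℕ → ℕ) → Set
PresN {n} R f = ∀ {x y} → x ℕ.< n → y ℕ.< n → (ℕRel R x y ⇔ ℕRel R (f x) (f y))

module _ {n : ℕ} {R : BlockRel n} where

  ℕRel⁺ : ∀ {a b} → R a b → ℕRel R (toℕ a) (toℕ b)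
  ℕRel⁺ {a} {b} r = rel (toℕ<n a) (toℕ<n b) (subst₂ R (sym (fromℕ<-toℕ a _)) (sym (fromℕ<-toℕ b _)) r)

  ℕRel⁻ : ∀ {a b} → ℕRel R (toℕ a) (toℕ b) → R a b
  ℕRel⁻ {a} {b} (rel _ _ r) = subst₂ R (fromℕ<-toℕ a _) (fromℕ<-toℕ b _) r

  pres⇒presN : ∀ {f : ℕ → ℕ} {g : Fin n → Fin n} → (∀ x → toℕ (g x) ≡ f (toℕ x)) → Pres R g → PresN R f
  pres⇒presN {f} {g} g≡f pres {x} {y} x<n y<n = mk⇔ fwd bwd
    where
    eq : ∀ {x} (x<n : x ℕ.< n) → toℕ (g (fromℕ< x<n)) ≡ f x
    eq x<n = trans (g≡f _) (cong f (toℕ-fromℕ< x<n))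
    fwd : ℕRel R x y → ℕRel R (f x) (f y)
    fwd (rel _ _ r) = subst₂ (ℕRel R) (eq x<n) (eq y<n) (ℕRel⁺ (to (pres _ _) r))
    bwd : ℕRel R (f x) (f y) → ℕRel R x y
    bwd r = rel x<n y<n (from (pres _ _) (ℕRel⁻ (subst₂ (ℕRel R) (sym (eq x<n)) (sym (eq y<n)) r)))

-- Neighbours related by pairs of interval cycles

module _ {n : ℕ} {R : BlockRel n} (eqv : IsEquivalence R) where
  private module E = IsEquivalence eqv

  ℕrefl : ∀ {x} → x ℕ.< n → ℕRel R x x
  ℕrefl x<n = rel x<n x<n E.refl

  ℕsym : ∀ {x y} → ℕRel R x y → ℕRel R y x
  ℕsym (rel p q r) = rel q p (E.sym r)

  ℕtrans : ∀ {x y z} → ℕRel R x y → ℕRel R y z → ℕRel R x z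
  ℕtrans (rel p _ r) (rel _ q s) = rel p q (E.trans r s)

  module _ (mate : ∀ a → ∃ λ b → b ≢ a × R a b) where

    -- h⁻¹ ∘ g is the transposition of x₀ and x₁, and the mate of x₀ is either x₁ or fixed by it.
    pres-transposition : ∀ {g h} → PresN R g → PresN R h → ∀ {x₀ x₁} → x₀ ℕ.< n → x₁ ℕ.< n →
      g x₀ ≡ h x₁ → (∀ z → z ≢ x₀ → z ≢ x₁ → g z ≡ h z) → ℕRel R x₀ x₁
    pres-transposition {g} {h} pg ph {x₀} {x₁} x₀<n x₁<n eq same with mate (fromℕ< x₀<n)
    ... | z , z≢ , r with toℕ z ℕ.≟ x₁
    ...   | yes refl = subst (λ w → ℕRel R w (toℕ z)) (toℕ-fromℕ< x₀<n) (ℕRel⁺ r)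
    ...   | no z≢x₁ = ℕtrans x₀~z (ℕsym (from (ph x₁<n (toℕ<n z)) (subst₂ (ℕRel R) eq (same _ z≢x₀ z≢x₁) (to (pg x₀<n (toℕ<n z)) x₀~z))))
      where
      x₀~z : ℕRel R x₀ (toℕ z)
      x₀~z = subst (λ w → ℕRel R w (toℕ z)) (toℕ-fromℕ< x₀<n) (ℕRel⁺ r)
      z≢x₀ : toℕ z ≢ x₀
      z≢x₀ e = z≢ (toℕ-injective (trans e (sym (toℕ-fromℕ< x₀<n))))

    -- The two cycles differ by the transposition of p and q, so p ~ q. Applying `cyc p q` once
    -- gives p + 1 ~ p, and applying it further carries this relation up the interval.
    cyc-cycˡ : ∀ {p q} → suc p ℕ.≤ q → q ℕ.< n → PresN R (cyc p q) → PresN R (cyc (suc p) q) →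
      ∀ k → p + k ℕ.< q → ℕRel R (p + k) (suc (p + k))
    cyc-cycˡ {p} {q} p<q q<n pg ph = go
      where
      p<n = ℕ.<-trans p<q q<n
      same : ∀ z → z ≢ p → z ≢ q → cyc p q z ≡ cyc (suc p) q z
      same z z≢p z≢q with ℕ.<-cmp z p | ℕ.<-cmp z q
      ... | tri< z<p _ _ | _ = trans (cyc-below z<p) (sym (cyc-below (ℕ.m≤n⇒m≤1+n z<p)))
      ... | tri≈ _ z≡p _ | _ = contradiction z≡p z≢p
      ... | tri> _ _ p<z | tri< z<q _ _ = trans (cyc-mid (ℕ.<⇒≤ p<z) z<q) (sym (cyc-mid p<z z<q))
      ... | tri> _ _ p<z | tri≈ _ z≡q _ = contradiction z≡q z≢q
      ... | tri> _ _ p<z | tri> _ _ q<z = trans (cyc-above {p} q<z) (sym (cyc-above {suc p} q<z))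
      p~q : ℕRel R p q
      p~q = pres-transposition pg ph p<n q<n (trans (cyc-mid ℕ.≤-refl p<q) (sym (cyc-end p<q))) same
      go : ∀ k → p + k ℕ.< q → ℕRel R (p + k) (suc (p + k))
      go zero _ rewrite ℕ.+-identityʳ p = ℕsym (subst₂ (ℕRel R) (cyc-mid ℕ.≤-refl p<q) (cyc-end (ℕ.<⇒≤ p<q)) (to (pg p<n q<n) p~q))
      go (suc k) lt rewrite ℕ.+-suc p k =
        subst₂ (ℕRel R) (cyc-mid (ℕ.m≤m+n p k) (ℕ.<-trans (ℕ.n<1+n _) lt)) (cyc-mid (ℕ.m≤n⇒m≤1+n (ℕ.m≤m+n p k)) lt)
          (to (pg (ℕ.<-trans (ℕ.<-trans (ℕ.n<1+n _) lt) q<n) (ℕ.<-trans lt q<n)) (go k (ℕ.<-trans (ℕ.n<1+n _) lt)))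

    -- The two cycles differ by the transposition of r and r + 1, so r ~ r + 1. Pulling back along
    -- `cyc p (suc r)` carries this relation down to p.
    cyc-cycʳ : ∀ {p r} → p ℕ.≤ r → suc r ℕ.< n → PresN R (cyc p (suc r)) → PresN R (cyc p r) →
      ∀ {x} k → p ℕ.≤ x → x + k ≡ r → ℕRel R x (suc x)
    cyc-cycʳ {p} {r} p≤r r<n pg ph = go
      where
      same : ∀ z → z ≢ suc r → z ≢ r → cyc p (suc r) z ≡ cyc p r z
      same z z≢q z≢r with ℕ.<-cmp z r | z ℕ.<? p
      ... | _ | yes z<p = trans (cyc-below z<p) (sym (cyc-below z<p))
      ... | tri< z<r _ _ | no z≮p = trans (cyc-mid (ℕ.≮⇒≥ z≮p) (ℕ.m≤n⇒m≤1+n z<r)) (sym (cyc-mid (ℕ.≮⇒≥ z≮p) z<r))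
      ... | tri≈ _ z≡r _ | _ = contradiction z≡r z≢r
      ... | tri> _ _ r<z | _ = trans (cyc-above {p} (ℕ.≤∧≢⇒< r<z (z≢q ∘ sym))) (sym (cyc-above {p} r<z))
      q~r : ℕRel R (suc r) r
      q~r = pres-transposition pg ph r<n (ℕ.<-trans (ℕ.n<1+n r) r<n) (trans (cyc-end (ℕ.m≤n⇒m≤1+n p≤r)) (sym (cyc-end p≤r))) same
      go : ∀ {x} k → p ℕ.≤ x → x + k ≡ r → ℕRel R x (suc x)
      go {x} zero p≤x eq with refl ← trans (sym (ℕ.+-identityʳ x)) eq = ℕsym q~r
      go {x} (suc k) p≤x eq = from (pg (ℕ.<-trans (ℕ.n<1+n x) sx<n) sx<n)
          (subst₂ (ℕRel R) (sym (cyc-mid p≤x (ℕ.m≤n⇒m≤1+n sx≤r))) (sym (cyc-mid (ℕ.m≤n⇒m≤1+n p≤x) (s≤s sx≤r)))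
            (go k (ℕ.m≤n⇒m≤1+n p≤x) (trans (sym (ℕ.+-suc x k)) eq)))
        where
        sx≤r : suc x ℕ.≤ r
        sx≤r = subst (suc x ℕ.≤_) (trans (sym (ℕ.+-suc x k)) eq) (ℕ.m≤m+n (suc x) k)
        sx<n : suc x ℕ.< n
        sx<n = ℕ.<-trans (s≤s sx≤r) r<n

    module _ {I : ℕ} (0<I : 0 ℕ.< I) (θ : Permutation′ (suc I + n)) (θ∈ : Comp (suc I + n) (Aut R) θ)
             {u v : Fin (suc I + n)} (adj : Adjacent (toℕ (θ ⟨$⟩ʳ u)) (toℕ (θ ⟨$⟩ʳ v))) where

      private
        cycles : ∀ {p q} e d → p ℕ.≤ q → q ℕ.< n → e + d ℕ.≤ I → toℕ u ≡ p + e → toℕ v ≡ suc q + (e + d) → PresN R (cyc p q)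
        cycles e d p≤q q<n e+d≤I u≡ v≡ = pres⇒presN (λ x → toℕ-fromℕ< (cyc-< p≤q q<n (toℕ<n x)))
          (adjacent⇒cyc-pres eqv θ θ∈ p≤q q<n e+d≤I u≡ v≡ adj)

        -- Moving one deletion from below `u` to just after `u` turns the cycle of [p, q] into that
        -- of [p + 1, q], so `cyc-cycˡ` applies.
        shrinkˡ : ∀ {p q} e d → suc p ℕ.≤ q → q ℕ.< n → suc (e + d) ℕ.≤ I → toℕ u ≡ suc (p + e) → toℕ v ≡ suc q + suc (e + d) →
          ∀ {c} → p ℕ.≤ c → c ℕ.< q → ℕRel R c (suc c)
        shrinkˡ {p} {q} e d p<q q<n le u≡ v≡ {c} p≤c c<q with ℕ.m≤n⇒∃[o]m+o≡n p≤c
        ... | k , refl = cyc-cycˡ p<q q<n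
          (cycles (suc e) d (ℕ.<⇒≤ p<q) q<n le (trans u≡ (sym (ℕ.+-suc p e))) v≡)
          (cycles e (suc d) p<q q<n (subst (ℕ._≤ I) (sym (ℕ.+-suc e d)) le) u≡ (trans v≡ (cong (suc q +_) (sym (ℕ.+-suc e d))))) k c<q

        excess : ∀ {c} → suc c ℕ.< n → suc (suc c) ℕ.≤ toℕ v → suc (suc c) + (toℕ v ℕ.∸ n) ℕ.≤ toℕ v
        excess {c} c<n c<v with ℕ.≤-total (toℕ v) n
        ... | inj₁ v≤n rewrite ℕ.m≤n⇒m∸n≡0 v≤n | ℕ.+-identityʳ c = c<v
        ... | inj₂ n≤v = subst (suc (suc c) + (toℕ v ℕ.∸ n) ℕ.≤_) (ℕ.m+[n∸m]≡n n≤v) (ℕ.+-monoˡ-≤ (toℕ v ℕ.∸ n) c<n)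

        v≤ : toℕ v ℕ.≤ I + n
        v≤ = ℕ.≤-pred (toℕ<n v)

        split : ∀ {c E} → suc (suc c) + E ℕ.≤ toℕ v → toℕ v ℕ.≤ n + E →
          ∃ λ q → c ℕ.< q × q ℕ.< n × toℕ v ≡ suc q + E
        split {c} {E} lo hi with ℕ.m≤n⇒∃[o]m+o≡n lo
        ... | o , eq = suc (c + o) , s≤s (ℕ.m≤m+n c o) , ℕ.+-cancelʳ-≤ E _ _ (subst (ℕ._≤ n + E) v≡ hi) , v≡
          where
          v≡ : toℕ v ≡ suc (suc (c + o)) + E
          v≡ = trans (sym eq) (cong (2 +_) (trans (ℕ.+-assoc c E o) (trans (cong (c +_) (ℕ.+-comm E o)) (sym (ℕ.+-assoc c o E)))))

      -- With `θ` = τ⁻¹, the neighbouring values `u` and `v` of τ jump over c + s + 1. If an index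
      -- below `u` or above `v` can be traded for one between them, two cycles around c arise that
      -- differ in one endpoint. Otherwise `u` and `v` are the extreme indices and the cycle is the
      -- long one.
      transition : ∀ {c s} → suc c ℕ.< n → s ℕ.≤ I → toℕ u ℕ.≤ c + s → suc (suc (c + s)) ℕ.≤ toℕ v →
        ℕRel R c (suc c) ⊎ (toℕ u ≡ 0 × toℕ v ≡ I + n × PresN R (cyc 0 (ℕ.pred n)))
      transition {c} {s} c<n s≤I u≤ ≤v with c ℕ.<? toℕ u
      ... | yes c<u with ℕ.m≤n⇒∃[o]m+o≡n c<u
      ...   | e , eq = inj₁ (body (split lo hi) (ℕ.m≤n⇒∃[o]m+o≡n (ℕ.m≤m⊔n (suc e) (toℕ v ℕ.∸ n))))
        where
        -- The number of deletions below `v`: e + 1 of them bring `u` down to c, and `toℕ v ∸ n` of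
        -- them suffice to bring `v` down to at most n.
        E = suc e ℕ.⊔ (toℕ v ℕ.∸ n)
        e≤s : suc e ℕ.≤ s
        e≤s = ℕ.+-cancelˡ-≤ c _ _ (subst (ℕ._≤ c + s) (trans (sym eq) (sym (ℕ.+-suc c e))) u≤)
        lo : suc (suc c) + E ℕ.≤ toℕ v
        lo with ℕ.⊔-sel (suc e) (toℕ v ℕ.∸ n)
        ... | inj₁ E≡ rewrite E≡ = ℕ.≤-trans (s≤s (s≤s (ℕ.+-monoʳ-≤ c e≤s))) ≤v
        ... | inj₂ E≡ rewrite E≡ = excess c<n (ℕ.≤-trans (s≤s (s≤s (ℕ.m≤m+n c s))) ≤v)
        hi : toℕ v ℕ.≤ n + E
        hi = ℕ.≤-trans (ℕ.m≤n+m∸n (toℕ v) n) (ℕ.+-monoʳ-≤ n (ℕ.m≤n⊔m (suc e) _))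
        E≤I : E ℕ.≤ I
        E≤I = ℕ.⊔-lub (ℕ.≤-trans e≤s s≤I) (ℕ.m≤n+o⇒m∸n≤o (toℕ v) n (subst (toℕ v ℕ.≤_) (ℕ.+-comm I n) v≤))
        body : (∃ λ q → c ℕ.< q × q ℕ.< n × toℕ v ≡ suc q + E) → (∃ λ d → suc e + d ≡ E) → ℕRel R c (suc c)
        body (q , c<q , q<n , v≡) (d , E≡) = shrinkˡ e d c<q q<n (subst (ℕ._≤ I) (sym E≡) E≤I) (sym eq)
          (trans v≡ (cong (suc q +_) (sym E≡))) ℕ.≤-refl c<q
      transition {c} {s} c<n s≤I u≤ ≤v | no c≮u with toℕ v ℕ.<? I + n
      ... | yes v<I+n = inj₁ (body (split lo (ℕ.m≤n+m∸n (toℕ v) n)))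
        where
        u≤c = ℕ.≮⇒≥ c≮u
        -- The fewest deletions between `u` and `v` that bring `v` down to at most n. As `v` is not
        -- the last index, d < I and one more is possible.
        d = toℕ v ℕ.∸ n
        lo : suc (suc c) + d ℕ.≤ toℕ v
        lo = excess c<n (ℕ.≤-trans (s≤s (s≤s (ℕ.m≤m+n c s))) ≤v)
        d<I : d ℕ.< I
        d<I with ℕ.≤-total (toℕ v) n
        ... | inj₁ v≤n rewrite ℕ.m≤n⇒m∸n≡0 v≤n = 0<I
        ... | inj₂ n≤v = ℕ.+-cancelˡ-< n _ _ (subst₂ ℕ._<_ (sym (ℕ.m+[n∸m]≡n n≤v)) (ℕ.+-comm I n) v<I+n)
        body : (∃ λ q → c ℕ.< q × q ℕ.< n × toℕ v ≡ suc q + d) → ℕRel R c (suc c)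
        body (suc r , s≤s c≤r , q<n , v≡) with ℕ.m≤n⇒∃[o]m+o≡n c≤r
        ... | k , eq = cyc-cycʳ u≤r q<n
            (cycles 0 d (ℕ.m≤n⇒m≤1+n u≤r) q<n (ℕ.<⇒≤ d<I) (sym (ℕ.+-identityʳ _)) v≡)
            (cycles 0 (suc d) u≤r (ℕ.<-trans (ℕ.n<1+n r) q<n) d<I (sym (ℕ.+-identityʳ _)) (trans v≡ (cong suc (sym (ℕ.+-suc r d)))))
            k u≤c eq
          where
          u≤r = ℕ.≤-trans u≤c c≤r
      ... | no v≮ = ends (toℕ u) refl
        where
        u≤c = ℕ.≮⇒≥ c≮u
        v≡ : toℕ v ≡ I + n
        v≡ = ℕ.≤-antisym v≤ (ℕ.≮⇒≥ v≮)
        1+[n-1] : suc (ℕ.pred n) ≡ n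
        1+[n-1] = ℕ.suc-pred n {{ℕ.>-nonZero (ℕ.≤-<-trans z≤n c<n)}}
        v≡′ : toℕ v ≡ suc (ℕ.pred n) + I
        v≡′ = trans v≡ (trans (ℕ.+-comm I n) (cong (_+ I) (sym 1+[n-1])))
        n-1<n : ℕ.pred n ℕ.< n
        n-1<n = ℕ.≤-reflexive 1+[n-1]
        c<n-1 : c ℕ.< ℕ.pred n
        c<n-1 = ℕ.≤-pred (subst (suc c ℕ.<_) (sym 1+[n-1]) c<n)
        1+[I-1] : suc (ℕ.pred I) ≡ I
        1+[I-1] = ℕ.suc-pred I {{ℕ.>-nonZero 0<I}}
        ends : ∀ m → toℕ u ≡ m → ℕRel R c (suc c) ⊎ (toℕ u ≡ 0 × toℕ v ≡ I + n × PresN R (cyc 0 (ℕ.pred n)))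
        -- Nothing lies outside [u, v], so all I deletions fall between and the interval is the
        -- whole of [n].
        ends zero u≡ = inj₂ (u≡ , v≡ , cycles 0 I z≤n n-1<n ℕ.≤-refl u≡ v≡′)
        -- One of the I deletions can be taken below `u`.
        ends (suc p) u≡ = inj₁ (shrinkˡ 0 (ℕ.pred I) (ℕ.≤-<-trans p≤c c<n-1) n-1<n (ℕ.≤-reflexive 1+[I-1])
          (trans u≡ (cong suc (sym (ℕ.+-identityʳ p)))) (trans v≡′ (cong (suc (ℕ.pred n) +_) (sym 1+[I-1]))) p≤c c<n-1)
          where
          p≤c : p ℕ.≤ c
          p≤c = ℕ.<⇒≤ (subst (ℕ._≤ c) u≡ u≤c)

-- Walks that do not jump over a boundary

restrict-≤ : ∀ {n k l} (π : Permutation′ n) → k ℕ.≤ n →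
  (∀ x → toℕ x ℕ.< k → toℕ (π ⟨$⟩ʳ x) ℕ.< l) → k ℕ.≤ l
restrict-≤ {n} {k} {l} π k≤n maps = injective⇒≤ {f = λ x → fromℕ< (bound x)} λ {x} {y} eq →
  toℕ-injective (trans (sym (toℕ-fromℕ< (x<n x))) (trans (cong toℕ (⟨$⟩ʳ-injective π
    (toℕ-injective (trans (sym (toℕ-fromℕ< (bound x))) (trans (cong toℕ eq) (toℕ-fromℕ< (bound y))))))) (toℕ-fromℕ< (x<n y))))
  where
  x<n : ∀ (x : Fin k) → toℕ x ℕ.< n
  x<n x = ℕ.<-≤-trans (toℕ<n x) k≤n
  bound : ∀ (x : Fin k) → toℕ (π ⟨$⟩ʳ fromℕ< (x<n x)) ℕ.< l
  bound x = maps _ (subst (ℕ._< k) (sym (toℕ-fromℕ< (x<n x))) (toℕ<n x))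

-- An injective self-map of the first k points is onto them, so a value below k is already taken
-- there.
initial-reflect : ∀ {n k} (π : Permutation′ n) → (∀ x → toℕ x ℕ.< k → toℕ (π ⟨$⟩ʳ x) ℕ.< k) →
  ∀ x → toℕ (π ⟨$⟩ʳ x) ℕ.< k → toℕ x ℕ.< k
initial-reflect {n} {k} π maps x πx<k with n ℕ.≤? k
... | yes n≤k = ℕ.<-≤-trans (toℕ<n x) n≤k
... | no n≰k = subst (ℕ._< k) (cong toℕ z≡x) (subst (ℕ._< k) (sym (toℕ-fromℕ< (w<n w))) (toℕ<n w))
  where
  w<n : ∀ (w : Fin k) → toℕ w ℕ.< n
  w<n w = ℕ.<-trans (toℕ<n w) (ℕ.≰⇒> n≰k)
  bound : ∀ w → toℕ (π ⟨$⟩ʳ fromℕ< (w<n w)) ℕ.< k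
  bound w = maps _ (subst (ℕ._< k) (sym (toℕ-fromℕ< (w<n w))) (toℕ<n w))
  restricted : Fin k → Fin k
  restricted w = fromℕ< (bound w)
  inj : ∀ {a b} → restricted a ≡ restricted b → a ≡ b
  inj {a} {b} eq = toℕ-injective (trans (sym (toℕ-fromℕ< (w<n a))) (trans (cong toℕ (⟨$⟩ʳ-injective π
    (toℕ-injective (trans (sym (toℕ-fromℕ< (bound a))) (trans (cong toℕ eq) (toℕ-fromℕ< (bound b))))))) (toℕ-fromℕ< (w<n b))))
  ρ = injective⇒permutation restricted inj
  w = proj₁ ρ ⟨$⟩ˡ fromℕ< πx<k
  z≡x : fromℕ< (w<n w) ≡ x
  z≡x = ⟨$⟩ʳ-injective π (toℕ-injective (trans (sym (toℕ-fromℕ< (bound w)))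
    (trans (cong toℕ (trans (sym (proj₂ ρ w)) (inverseʳ (proj₁ ρ)))) (toℕ-fromℕ< πx<k))))

-- The boundary between C and C + 1 is named by its lower side.
Crosses : ℕ → ℕ → ℕ → Set
Crosses C x y = (x ℕ.≤ C × C ℕ.< y) ⊎ (y ℕ.≤ C × C ℕ.< x)

¬crosses-≡ : ∀ {C x y} → x ≡ y → ¬ Crosses C x y
¬crosses-≡ refl (inj₁ (x≤C , C<x)) = ℕ.<⇒≱ C<x x≤C
¬crosses-≡ refl (inj₂ (x≤C , C<x)) = ℕ.<⇒≱ C<x x≤C

module _ {M C : ℕ} (C<M : suc C ℕ.< M) (τ : Permutation′ (suc M))
  (noJump : ∀ u v → Adjacent (toℕ (τ ⟨$⟩ˡ u)) (toℕ (τ ⟨$⟩ˡ v)) → toℕ u ℕ.≤ C → ¬ (suc C ℕ.< toℕ v))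
  (forward : (τ ⟨$⟩ˡ zero) < (τ ⟨$⟩ˡ fromℕ M)) where

  private
    Low : Fin (suc M) → Set
    Low x = toℕ (τ ⟨$⟩ʳ x) ℕ.≤ C

    cut<N : suc C ℕ.< suc M
    cut<N = ℕ.m≤n⇒m≤1+n C<M

    pivot p₀ p₁ : Fin (suc M)
    pivot = τ ⟨$⟩ˡ fromℕ< cut<N
    p₀ = τ ⟨$⟩ˡ zero
    p₁ = τ ⟨$⟩ˡ fromℕ M

    τ-pivot : toℕ (τ ⟨$⟩ʳ pivot) ≡ suc C
    τ-pivot = trans (cong toℕ (inverseʳ τ)) (toℕ-fromℕ< cut<N)

    pivot-unique : ∀ x → toℕ (τ ⟨$⟩ʳ x) ≡ suc C → x ≡ pivot
    pivot-unique x eq = ⟨$⟩ʳ-injective τ (toℕ-injective (trans eq (sym τ-pivot)))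

    high : ∀ x → x ≢ pivot → ¬ Low x → suc C ℕ.< toℕ (τ ⟨$⟩ʳ x)
    high x x≢ ¬low = ℕ.≤∧≢⇒< (ℕ.≰⇒> ¬low) (x≢ ∘ pivot-unique x ∘ sym)

    step : ∀ x y → Adjacent (toℕ x) (toℕ y) → y ≢ pivot → Low x → Low y
    step x y adj y≢ low with toℕ (τ ⟨$⟩ʳ y) ℕ.≤? C
    ... | yes l = l
    ... | no ¬l = contradiction (high y y≢ ¬l) (noJump (τ ⟨$⟩ʳ x) (τ ⟨$⟩ʳ y) (subst₂ Adjacent (cong toℕ (sym (inverseˡ τ))) (cong toℕ (sym (inverseˡ τ))) adj) low)

    walk : ∀ k x y → toℕ y ≡ k + toℕ x → (∀ z → x Fin.≤ z → z Fin.≤ y → z ≢ pivot) → (Low x → Low y) × (Low y → Low x)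
    walk zero x y eq _ with refl ← toℕ-injective eq = (λ l → l) , (λ l → l)
    walk (suc k) x y eq avoid = step y′ y (inj₂ y≡) (avoid y (ℕ.≤-trans x≤y′ y′≤y) ℕ.≤-refl) ∘ proj₁ rec
                              , proj₂ rec ∘ step y y′ (inj₁ y≡) (avoid y′ x≤y′ y′≤y)
      where
      k<N : k + toℕ x ℕ.< suc M
      k<N = ℕ.<-trans (subst (k + toℕ x ℕ.<_) (sym eq) (ℕ.n<1+n _)) (toℕ<n y)
      y′ = fromℕ< k<N
      y′≡ : toℕ y′ ≡ k + toℕ x
      y′≡ = toℕ-fromℕ< k<N
      y≡ : toℕ y ≡ suc (toℕ y′)
      y≡ = trans eq (cong suc (sym y′≡))
      y′≤y : toℕ y′ ℕ.≤ toℕ y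
      y′≤y = subst (toℕ y′ ℕ.≤_) (sym y≡) (ℕ.n≤1+n _)
      x≤y′ : toℕ x ℕ.≤ toℕ y′
      x≤y′ = subst (toℕ x ℕ.≤_) (sym y′≡) (ℕ.m≤n+m (toℕ x) k)
      rec = walk k x y′ y′≡ λ z x≤z z≤y′ → avoid z x≤z (ℕ.≤-trans z≤y′ y′≤y)

    connected : ∀ x y → x Fin.≤ y → (∀ z → x Fin.≤ z → z Fin.≤ y → z ≢ pivot) → (Low x → Low y) × (Low y → Low x)
    connected x y x≤y = walk (toℕ y ℕ.∸ toℕ x) x y (sym (ℕ.m∸n+n≡m x≤y))

    left : ∀ x y → x Fin.≤ y → y < pivot → (Low x → Low y) × (Low y → Low x)
    left x y x≤y y<p = connected x y x≤y λ { z _ z≤y refl → ℕ.<⇒≱ y<p z≤y }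

    right : ∀ x y → x Fin.≤ y → pivot < x → (Low x → Low y) × (Low y → Low x)
    right x y x≤y p<x = connected x y x≤y λ { z x≤z _ refl → ℕ.<⇒≱ p<x x≤z }

    low₀ : Low p₀
    low₀ = subst (λ z → toℕ z ℕ.≤ C) (sym (inverseʳ τ)) z≤n

    ¬low₁ : ¬ Low p₁
    ¬low₁ l = ℕ.<⇒≱ (ℕ.<-trans (ℕ.n<1+n C) C<M) (subst (ℕ._≤ C) (trans (cong toℕ (inverseʳ τ)) (toℕ-fromℕ M)) l)

    p₀≢ : toℕ p₀ ≢ toℕ pivot
    p₀≢ eq = ℕ.<⇒≱ (ℕ.n<1+n C) (subst (ℕ._≤ C) (trans (cong (toℕ ∘ (τ ⟨$⟩ʳ_)) (toℕ-injective eq)) τ-pivot) low₀)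

    p₁≢ : toℕ p₁ ≢ toℕ pivot
    p₁≢ eq = ℕ.<⇒≢ C<M (trans (sym τ-pivot) (trans (cong (toℕ ∘ (τ ⟨$⟩ʳ_)) (toℕ-injective (sym eq))) (trans (cong toℕ (inverseʳ τ)) (toℕ-fromℕ M))))

    -- If 0 came after the pivot, so would M, and the walk would get from 0 to M without meeting C +
    -- 1.
    p₀< : p₀ < pivot
    p₀< = ℕ.≤∧≢⇒< (ℕ.≮⇒≥ λ p<p₀ → ¬low₁ (proj₁ (right p₀ p₁ (ℕ.<⇒≤ forward) p<p₀) low₀)) p₀≢

    <p₁ : pivot < p₁
    <p₁ = ℕ.≤∧≢⇒< (ℕ.≮⇒≥ λ p₁<p → ¬low₁ (proj₁ (left p₀ p₁ (ℕ.<⇒≤ forward) p₁<p) low₀)) (p₁≢ ∘ sym)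

    before : ∀ x → x < pivot → Low x
    before x x<p with ℕ.≤-total (toℕ x) (toℕ p₀)
    ... | inj₁ x≤p₀ = proj₂ (left x p₀ x≤p₀ p₀<) low₀
    ... | inj₂ p₀≤x = proj₁ (left p₀ x p₀≤x x<p) low₀

    after : ∀ x → pivot < x → ¬ Low x
    after x p<x l with ℕ.≤-total (toℕ x) (toℕ p₁)
    ... | inj₁ x≤p₁ = ¬low₁ (proj₁ (right x p₁ x≤p₁ p<x) l)
    ... | inj₂ p₁≤x = ¬low₁ (proj₂ (right p₁ x p₁≤x <p₁) l)

    -- The positions before the pivot are exactly those of the values up to C. Counting in both
    -- directions gives C + 1 of them.
    pivot≡ : toℕ pivot ≡ suc C
    pivot≡ = ℕ.≤-antisym
      (restrict-≤ τ (ℕ.<⇒≤ (toℕ<n pivot)) (λ x x<p → s≤s (before x x<p)))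
      (restrict-≤ (flip τ) (ℕ.<⇒≤ cut<N) λ { y (s≤s y≤C) → ℕ.≤∧≢⇒<
        (ℕ.≮⇒≥ λ p<θy → after _ p<θy (subst (λ z → toℕ z ℕ.≤ C) (sym (inverseʳ τ)) y≤C))
        λ eq → ℕ.<⇒≱ (ℕ.n<1+n C) (subst (ℕ._≤ C) (trans (cong toℕ (sym (inverseʳ τ))) (trans (cong (toℕ ∘ (τ ⟨$⟩ʳ_)) (toℕ-injective eq)) τ-pivot)) y≤C) })

  -- The walk changes sides only through the value C + 1, which it meets once, at `pivot`. Since 0
  -- comes before M, the low values precede the pivot and the high ones follow it. The pivot is at
  -- position C + 1, so both boundaries of that position are respected.
  noJump⇒¬crosses : ∀ x → ¬ Crosses C (toℕ x) (toℕ (τ ⟨$⟩ʳ x)) × ¬ Crosses (suc C) (toℕ x) (toℕ (τ ⟨$⟩ʳ x))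
  noJump⇒¬crosses x with <-cmp x pivot
  ... | tri< x<p _ _ = (λ { (inj₁ (_ , C<τx)) → ℕ.<⇒≱ C<τx (before x x<p)
                          ; (inj₂ (_ , C<x)) → ℕ.<⇒≱ (subst (toℕ x ℕ.<_) pivot≡ x<p) C<x })
                     , (λ { (inj₁ (_ , C<τx)) → ℕ.<⇒≱ C<τx (ℕ.m≤n⇒m≤1+n (before x x<p))
                          ; (inj₂ (_ , C<x)) → ℕ.<⇒≱ (subst (toℕ x ℕ.<_) pivot≡ x<p) (ℕ.<⇒≤ C<x) })
  ... | tri≈ _ refl _ = ¬crosses-≡ (trans pivot≡ (sym τ-pivot)) , ¬crosses-≡ (trans pivot≡ (sym τ-pivot))
  ... | tri> _ _ p<x = (λ { (inj₁ (x≤C , _)) → ℕ.<⇒≱ C<x (ℕ.m≤n⇒m≤1+n x≤C)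
                          ; (inj₂ (τx≤C , _)) → after x p<x τx≤C })
                     , (λ { (inj₁ (x≤C , _)) → ℕ.<⇒≱ C<x x≤C
                          ; (inj₂ (τx≤C , _)) → ℕ.<⇒≱ (high x (λ { refl → ℕ.<-irrefl refl p<x }) (after x p<x)) τx≤C })
    where
    C<x : suc C ℕ.< toℕ x
    C<x = subst (ℕ._< toℕ x) pivot≡ p<x

module _ {n I : ℕ} {R : BlockRel n} (T : Permutation′ (suc I + n))
  (jump⇒rel : ∀ {u v c s} → Adjacent (toℕ (T ⟨$⟩ˡ u)) (toℕ (T ⟨$⟩ˡ v)) → suc c ℕ.< n → s ℕ.≤ I →
    toℕ u ℕ.≤ c + s → suc (suc (c + s)) ℕ.≤ toℕ v → ℕRel R c (suc c))
  (forward : (T ⟨$⟩ˡ zero) < (T ⟨$⟩ˡ fromℕ (I + n))) where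

  private
    Jump : ℕ → Fin (suc I + n) → Fin (suc I + n) → Set
    Jump C u v = Adjacent (toℕ (T ⟨$⟩ˡ u)) (toℕ (T ⟨$⟩ˡ v)) × toℕ u ℕ.≤ C × suc C ℕ.< toℕ v

    -- Jumps are decidable even though `R` is not: a jump that is found yields the relation, and
    -- without one nothing crosses.
    jump? : ∀ C → Dec (∃ λ u → ∃ λ v → Jump C u v)
    jump? C = any? λ u → any? λ v →
      ((toℕ (T ⟨$⟩ˡ u) ℕ.≟ suc (toℕ (T ⟨$⟩ˡ v))) ⊎-dec (toℕ (T ⟨$⟩ˡ v) ℕ.≟ suc (toℕ (T ⟨$⟩ˡ u))))
        ×-dec (toℕ u ℕ.≤? C) ×-dec (suc C ℕ.<? toℕ v)

    either : ∀ {c s} → suc c ℕ.< n → s ℕ.≤ I → ∀ x →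
      Crosses (c + s) (toℕ x) (toℕ (T ⟨$⟩ʳ x)) ⊎ Crosses (suc (c + s)) (toℕ x) (toℕ (T ⟨$⟩ʳ x)) → ℕRel R c (suc c)
    either {c} {s} c<n s≤I x cr with jump? (c + s)
    ... | yes (u , v , adj , u≤ , <v) = jump⇒rel adj c<n s≤I u≤ <v
    ... | no ¬jump = contradiction cr λ { (inj₁ c₁) → proj₁ no-cross c₁ ; (inj₂ c₂) → proj₂ no-cross c₂ }
      where
      no-cross = noJump⇒¬crosses (subst (suc (c + s) ℕ.<_) (ℕ.+-comm n I) (ℕ.+-mono-<-≤ c<n s≤I)) T
        (λ u v adj u≤ <v → ¬jump (u , v , adj , u≤ , <v)) forward x

  -- For s ≤ I the boundary c + s is the lower one of `noJump⇒¬crosses`. The last boundary c + I + 1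
  -- is the upper one belonging to s = I.
  crosses⇒rel : ∀ {c s} → suc c ℕ.< n → s ℕ.≤ suc I → ∀ x → Crosses (c + s) (toℕ x) (toℕ (T ⟨$⟩ʳ x)) → ℕRel R c (suc c)
  crosses⇒rel {c} {s} c<n s≤ x cr with ℕ.m≤n⇒m<n∨m≡n s≤
  ... | inj₁ (s≤s s≤I) = either c<n s≤I x (inj₁ cr)
  ... | inj₂ refl = either c<n ℕ.≤-refl x (inj₂ (subst (λ C → Crosses C (toℕ x) (toℕ (T ⟨$⟩ʳ x))) (ℕ.+-suc c I) cr))

-- The interval partitions Π^(i)

crosses-sym : ∀ {c x y} → Crosses c x y → Crosses c y x
crosses-sym (inj₁ p) = inj₂ p
crosses-sym (inj₂ p) = inj₁ p

crosses-split : ∀ {c x z} y → Crosses c x z → Crosses c x y ⊎ Crosses c y z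
crosses-split {c} y (inj₁ (x≤c , c<z)) with y ℕ.≤? c
... | yes y≤c = inj₂ (inj₁ (y≤c , c<z))
... | no y≰c = inj₁ (inj₁ (x≤c , ℕ.≰⇒> y≰c))
crosses-split {c} y (inj₂ (z≤c , c<x)) with y ℕ.≤? c
... | yes y≤c = inj₁ (inj₂ (y≤c , c<x))
... | no y≰c = inj₂ (inj₂ (z≤c , ℕ.≰⇒> y≰c))

crosses-between : ∀ {n} {x y k : Fin n} {c} → between x y k → Crosses c (toℕ x) (toℕ k) → Crosses c (toℕ x) (toℕ y)
crosses-between (inj₁ (x≤k , k≤y)) (inj₁ (x≤c , c<k)) = inj₁ (x≤c , ℕ.<-≤-trans c<k k≤y)
crosses-between (inj₁ (x≤k , k≤y)) (inj₂ (k≤c , c<x)) = contradiction (ℕ.≤-trans x≤k k≤c) (ℕ.<⇒≱ c<x)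
crosses-between (inj₂ (y≤k , k≤x)) (inj₁ (x≤c , c<k)) = contradiction (ℕ.≤-trans k≤x x≤c) (ℕ.<⇒≱ c<k)
crosses-between (inj₂ (y≤k , k≤x)) (inj₂ (k≤c , c<x)) = inj₂ (ℕ.≤-trans y≤k k≤c , c<x)

between-right : ∀ {n} (x y : Fin n) → between x y y
between-right x y with ℕ.≤-total (toℕ x) (toℕ y)
... | inj₁ x≤y = inj₁ (x≤y , ℕ.≤-refl)
... | inj₂ y≤x = inj₂ (ℕ.≤-refl , y≤x)

-- An interval partition is described by its joints: J c says that c and c+1 lie in the same block.
Joints : ∀ {n} → BlockRel n → (ℕ → Set) → Set
Joints Q J = ∀ x y → (Q x y ⇔ (∀ c → Crosses c (toℕ x) (toℕ y) → J c))

module _ {n : ℕ} {Q : BlockRel n} {J : ℕ → Set} (joints : Joints Q J) where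

  joints-sym : ∀ {x y} → Q x y → Q y x
  joints-sym q = from (joints _ _) λ c cr → to (joints _ _) q c (crosses-sym cr)

  joints⇒isEquivalence : IsEquivalence Q
  joints⇒isEquivalence = record
    { refl = from (joints _ _) λ c cr → contradiction cr (¬crosses-≡ refl)
    ; sym = joints-sym
    ; trans = λ {_} {y} p q → from (joints _ _) λ c cr → case c p q (crosses-split (toℕ y) cr)
    }
    where
    case : ∀ {x y z} c → Q x y → Q y z → Crosses c (toℕ x) (toℕ y) ⊎ Crosses c (toℕ y) (toℕ z) → J c
    case c p q (inj₁ cr) = to (joints _ _) p c cr
    case c p q (inj₂ cr) = to (joints _ _) q c cr

  -- A partition described by joints consists of intervals, so `hat` leaves it unchanged.
  joints-hat : Joints (hat Q) J
  joints-hat x y = mk⇔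
    (λ h → to (joints x y) (joints-sym (h y (between-right x y))))
    (λ js k b → joints-sym (from (joints x k) λ c cr → js c (crosses-between b cr)))

  joints-cong : ∀ {J′} → (∀ c → J c ⇔ J′ c) → Joints Q J′
  joints-cong J⇔J′ x y = mk⇔
    (λ q c cr → to (J⇔J′ c) (to (joints x y) q c cr))
    (λ js → from (joints x y) λ c cr → from (J⇔J′ c) (js c cr))

data DropLast {n : ℕ} (x : Fin (suc n)) : Maybe (Fin n) → Set where
  kept    : ∀ j → toℕ j ≡ toℕ x → DropLast x (just j)
  dropped : toℕ x ≡ n → DropLast x nothing

dropLast-view : ∀ {n} (x : Fin (suc n)) → DropLast x (dropLast x)
dropLast-view {zero} zero = dropped refl
dropLast-view {suc n} zero = kept zero refl
dropLast-view {suc n} (suc x) with dropLast x | dropLast-view x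
... | just j  | kept .j eq = kept (suc j) (cong suc eq)
... | nothing | dropped eq = dropped (cong suc eq)

module _ {m : ℕ} {R : BlockRel (suc m)} {J : ℕ → Set} (joints : Joints (hat R) J) where

  -- Prepending a point to the first block shifts every joint by one and adds a joint at 0, where
  -- the condition is void. The map `down` merges the new point with its neighbour.
  joints-hat1 : Joints (hat1 R) (λ c → ∀ c′ → c ≡ suc c′ → J c′)
  joints-hat1 x y = mk⇔
    (λ { h .(suc c′) cr c′ refl → to (joints (down x) (down y)) (hat1⇒ x y h) c′ (crosses⇒ x y cr) })
    (λ js → ⇒hat1 x y (from (joints (down x) (down y)) λ c cr → js (suc c) (⇒crosses x y cr) c refl))
    where
    down : Fin (suc (suc m)) → Fin (suc m)
    down zero = zero
    down (suc j) = j

    hat1⇒ : ∀ x y → hat1 R x y → hat R (down x) (down y)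
    hat1⇒ zero zero _ = from (joints _ _) λ c cr → contradiction cr (¬crosses-≡ refl)
    hat1⇒ zero (suc y) h = joints-sym joints h
    hat1⇒ (suc x) zero h = h
    hat1⇒ (suc x) (suc y) h = h

    ⇒hat1 : ∀ x y → hat R (down x) (down y) → hat1 R x y
    ⇒hat1 zero zero _ = tt
    ⇒hat1 zero (suc y) h = joints-sym joints h
    ⇒hat1 (suc x) zero h = h
    ⇒hat1 (suc x) (suc y) h = h

    down-≤ : ∀ {c} x → toℕ x ℕ.≤ suc c → toℕ (down x) ℕ.≤ c
    down-≤ zero _ = z≤n
    down-≤ (suc x) (s≤s le) = le
    ≤-down : ∀ {c} x → toℕ (down x) ℕ.≤ c → toℕ x ℕ.≤ suc c
    ≤-down zero _ = z≤n
    ≤-down (suc x) le = s≤s le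
    down-> : ∀ {c} x → suc c ℕ.< toℕ x → c ℕ.< toℕ (down x)
    down-> (suc x) (s≤s lt) = lt
    >-down : ∀ {c} x → c ℕ.< toℕ (down x) → suc c ℕ.< toℕ x
    >-down (suc x) lt = s≤s lt

    crosses⇒ : ∀ {c} x y → Crosses (suc c) (toℕ x) (toℕ y) → Crosses c (toℕ (down x)) (toℕ (down y))
    crosses⇒ x y (inj₁ (p , q)) = inj₁ (down-≤ x p , down-> y q)
    crosses⇒ x y (inj₂ (p , q)) = inj₂ (down-≤ y p , down-> x q)
    ⇒crosses : ∀ {c} x y → Crosses c (toℕ (down x)) (toℕ (down y)) → Crosses (suc c) (toℕ x) (toℕ y)
    ⇒crosses x y (inj₁ (p , q)) = inj₁ (≤-down x p , >-down y q)
    ⇒crosses x y (inj₂ (p , q)) = inj₂ (≤-down y p , >-down x q)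

  private
    lastBlock : (∀ c → m ℕ.≤ c → J c) → ∀ j → hat R j (fromℕ m) ⇔ (∀ c → Crosses c (toℕ j) (suc m) → J c)
    lastBlock last j = mk⇔ fwd (λ js → from (joints j (fromℕ m)) λ c → λ where
        (inj₁ (j≤c , c<m)) → js c (inj₁ (j≤c , ℕ.m≤n⇒m≤1+n (subst (c ℕ.<_) (toℕ-fromℕ m) c<m)))
        (inj₂ (m≤c , c<j)) → last c (subst (ℕ._≤ c) (toℕ-fromℕ m) m≤c))
      where
      fwd : hat R j (fromℕ m) → ∀ c → Crosses c (toℕ j) (suc m) → J c
      fwd h c cr with m ℕ.≤? c
      ... | yes m≤c = last c m≤c
      fwd h c (inj₁ (j≤c , _)) | no m≰c = to (joints j (fromℕ m)) h c (inj₁ (j≤c , subst (c ℕ.<_) (sym (toℕ-fromℕ m)) (ℕ.≰⇒> m≰c)))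
      fwd h c (inj₂ (m<c , _)) | no m≰c = contradiction (ℕ.<⇒≤ m<c) m≰c

  -- Appending a point to the last block keeps the old joints and creates one at m, which `last`
  -- supplies.
  joints-hatN : (∀ c → m ℕ.≤ c → J c) → Joints (hatN R) J
  joints-hatN last x y with dropLast x | dropLast-view x | dropLast y | dropLast-view y
  ... | just j | kept .j j≡ | just k | kept .k k≡ = subst₂ (λ a b → hat R j k ⇔ (∀ c → Crosses c a b → J c)) j≡ k≡ (joints j k)
  ... | nothing | dropped x≡ | nothing | dropped y≡ = mk⇔
    (λ _ c cr → contradiction cr (¬crosses-≡ (trans x≡ (sym y≡)))) (λ _ → tt)
  ... | just j | kept .j j≡ | nothing | dropped y≡ rewrite sym j≡ | y≡ = lastBlock last j
  ... | nothing | dropped x≡ | just k | kept .k k≡ rewrite sym k≡ | x≡ = mk⇔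
    (λ h c → to (lastBlock last k) h c ∘ crosses-sym)
    (λ js → from (lastBlock last k) λ c → js c ∘ crosses-sym)

joints-prime : ∀ {m} {R : BlockRel m} {J : ℕ → Set} → Joints (hat R) J → (∀ c → m ℕ.≤ suc c → J c) →
  Joints (prime R) (λ c → J c × (∀ c′ → c ≡ suc c′ → J c′))
joints-prime {zero} joints last zero zero = mk⇔ (λ _ c cr → contradiction cr (¬crosses-≡ refl)) (λ _ → tt , tt)
joints-prime {suc m} joints last x y = mk⇔
  (λ { (h₁ , hₙ) c cr → to (joints-hatN joints (λ c m≤c → last c (s≤s m≤c)) x y) hₙ c cr , to (joints-hat1 joints x y) h₁ c cr })
  (λ js → from (joints-hat1 joints x y) (λ c cr → proj₂ (js c cr))
        , from (joints-hatN joints (λ c m≤c → last c (s≤s m≤c)) x y) (λ c cr → proj₁ (js c cr)))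

module _ {n : ℕ} {R : BlockRel n} (eqv : IsEquivalence R) where

  private
    chain-≤ : ∀ k {x y} → k + x ≡ y → y ℕ.< n → (∀ c → x ℕ.≤ c → c ℕ.< y → suc c ℕ.< n → ℕRel R c (suc c)) → ℕRel R x y
    chain-≤ zero refl x<n _ = ℕrefl eqv x<n
    chain-≤ (suc k) {x} refl y<n js = ℕtrans eqv
      (chain-≤ k refl (ℕ.<-trans (ℕ.n<1+n _) y<n) (λ c x≤c c< → js c x≤c (ℕ.m≤n⇒m≤1+n c<)))
      (js (k + x) (ℕ.m≤n+m x k) (ℕ.n<1+n _) y<n)

  chain : ∀ {x y} → x ℕ.< n → y ℕ.< n → (∀ c → Crosses c x y → suc c ℕ.< n → ℕRel R c (suc c)) → ℕRel R x y
  chain {x} {y} x<n y<n js with ℕ.≤-total x y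
  ... | inj₁ x≤y = chain-≤ (y ℕ.∸ x) (ℕ.m∸n+n≡m x≤y) y<n (λ c x≤c c<y → js c (inj₁ (x≤c , c<y)))
  ... | inj₂ y≤x = ℕsym eqv (chain-≤ (x ℕ.∸ y) (ℕ.m∸n+n≡m y≤x) x<n (λ c y≤c c<x → js c (inj₂ (y≤c , c<x))))

  -- Each `prime` makes a boundary of the partition spread one place further, so the boundary c′ of
  -- [n] governs c′, ..., c′ + i. Positions outside [n] impose no condition.
  IterJoint : ℕ → ℕ → Set
  IterJoint i c = ∀ c′ s → suc c′ ℕ.< n → s ℕ.≤ i → c ≡ c′ + s → ℕRel R c′ (suc c′)

  -- `R` itself need not consist of intervals, but `prime` sees a partition only through `hat`, so
  -- the induction runs on `hat (iter i R)`.
  joints-hat-iter : ∀ i → Joints (hat (iter i R)) (IterJoint i)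
  joints-iter : ∀ i → Joints (iter (suc i) R) (IterJoint (suc i))

  joints-hat-iter zero x y = mk⇔ fwd bwd
    where
    fwd : hat R x y → ∀ c → Crosses c (toℕ x) (toℕ y) → IterJoint 0 c
    fwd h c cr c′ zero c<n _ eq with refl ← trans eq (ℕ.+-identityʳ c′) =
      rel (ℕ.<-trans (ℕ.n<1+n c) c<n) c<n (IsEquivalence.trans eqv
        (h _ (at (ℕ.<-trans (ℕ.n<1+n c) c<n) ℕ.≤-refl (ℕ.n≤1+n c) cr))
        (IsEquivalence.sym eqv (h _ (at c<n (ℕ.n≤1+n c) ℕ.≤-refl cr))))
      where
      at : ∀ {d} (d<n : d ℕ.< n) → c ℕ.≤ d → d ℕ.≤ suc c → Crosses c (toℕ x) (toℕ y) → between x y (fromℕ< d<n)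
      at {d} d<n c≤d d≤ (inj₁ (x≤c , c<y)) = inj₁
        ( subst (toℕ x ℕ.≤_) (sym (toℕ-fromℕ< d<n)) (ℕ.≤-trans x≤c c≤d)
        , subst (ℕ._≤ toℕ y) (sym (toℕ-fromℕ< d<n)) (ℕ.≤-trans d≤ c<y))
      at {d} d<n c≤d d≤ (inj₂ (y≤c , c<x)) = inj₂
        ( subst (toℕ y ℕ.≤_) (sym (toℕ-fromℕ< d<n)) (ℕ.≤-trans y≤c c≤d)
        , subst (ℕ._≤ toℕ x) (sym (toℕ-fromℕ< d<n)) (ℕ.≤-trans d≤ c<x))
    bwd : (∀ c → Crosses c (toℕ x) (toℕ y) → IterJoint 0 c) → hat R x y
    bwd js k b = ℕRel⁻ (ℕsym eqv (chain (toℕ<n x) (toℕ<n k) λ c cr c<n →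
      js c (crosses-between b cr) c 0 c<n z≤n (sym (ℕ.+-identityʳ c))))
  joints-hat-iter (suc i) = joints-hat (joints-iter i)

  joints-iter i = joints-cong (joints-prime (joints-hat-iter i) last) λ c → mk⇔ (fwd c) (bwd c)
    where
    last : ∀ c → i + n ℕ.≤ suc c → IterJoint i c
    last c le c′ s c′<n s≤i refl = contradiction (subst (ℕ._≤ suc (c′ + s)) (ℕ.+-comm i n) le) (ℕ.<⇒≱ (ℕ.+-mono-<-≤ c′<n s≤i))
    fwd : ∀ c → IterJoint i c × (∀ c′ → c ≡ suc c′ → IterJoint i c′) → IterJoint (suc i) c
    fwd c (js , js′) c′ s c′<n s≤ eq with ℕ.m≤n⇒m<n∨m≡n s≤
    ... | inj₁ (s≤s s≤i) = js c′ s c′<n s≤i eq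
    ... | inj₂ refl = js′ (c′ + i) (trans eq (ℕ.+-suc c′ i)) c′ i c′<n ℕ.≤-refl refl
    bwd : ∀ c → IterJoint (suc i) c → IterJoint i c × (∀ c′ → c ≡ suc c′ → IterJoint i c′)
    bwd c js = (λ c′ s c′<n s≤i → js c′ s c′<n (ℕ.m≤n⇒m≤1+n s≤i))
      , λ { d refl c′ s c′<n s≤i refl → js c′ (suc s) c′<n (s≤s s≤i) (sym (ℕ.+-suc c′ s)) }

-- The reversal and the long cycle

opposite-anti : ∀ {n} {x y : Fin n} → x < y → opposite y < opposite x
opposite-anti {n} {x} {y} x<y = subst₂ ℕ._<_ (sym (opposite-prop y)) (sym (opposite-prop x)) (ℕ.∸-monoʳ-< (s≤s x<y) (toℕ<n y))

opposite-< : ∀ {n} {x y : Fin n} → (opposite x < opposite y ⇔ y < x)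
opposite-< {x = x} {y} = mk⇔ (subst₂ _<_ (opposite-involutive y) (opposite-involutive x) ∘ opposite-anti) opposite-anti

toℕ-opposite : ∀ {n} (x : Fin n) → suc (toℕ x + toℕ (opposite x)) ≡ n
toℕ-opposite x = trans (cong (suc (toℕ x) +_) (opposite-prop x)) (ℕ.m+[n∸m]≡n (toℕ<n x))

opposite-adjacent : ∀ {n} {x y : Fin n} → Adjacent (toℕ x) (toℕ y) → Adjacent (toℕ (opposite x)) (toℕ (opposite y))
opposite-adjacent {n} {x} {y} (inj₁ x≡) = inj₂ (ℕ.+-cancelˡ-≡ (suc (toℕ y)) _ _ (trans (toℕ-opposite y)
  (trans (sym (toℕ-opposite x)) (trans (cong (λ z → suc (z + toℕ (opposite x))) x≡) (sym (ℕ.+-suc (suc (toℕ y)) (toℕ (opposite x))))))))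
opposite-adjacent {n} {x} {y} (inj₂ y≡) = adjacent-sym (opposite-adjacent (inj₁ y≡))

opposite-adjacent⁻ : ∀ {n} {x y : Fin n} → Adjacent (toℕ (opposite x)) (toℕ (opposite y)) → Adjacent (toℕ x) (toℕ y)
opposite-adjacent⁻ {x = x} {y} adj = subst₂ (λ a b → Adjacent (toℕ a) (toℕ b)) (opposite-involutive x) (opposite-involutive y) (opposite-adjacent adj)

pattern-δ : ∀ {n m} {π : Permutation′ m} → π ≐ δ → {ι : Fin n → Fin m} → StrictInc ι → OrderIso {n} δ ((π ⟨$⟩ʳ_) ∘ ι)
pattern-δ {π = π} π≐δ {ι} inc j k rewrite π≐δ (ι j) | π≐δ (ι k) = mk⇔
  (from opposite-< ∘ inc k j ∘ to opposite-<)
  (from opposite-< ∘ strictInc-reflects inc k j ∘ to opposite-<)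

toℕ-ζ-suc : ∀ {m} (x : Fin (suc m)) → toℕ x ℕ.< m → toℕ (ζ x) ≡ suc (toℕ x)
toℕ-ζ-suc x x<m with dropLast x | dropLast-view x
... | _ | kept j j≡ = cong suc j≡
... | _ | dropped x≡ = contradiction x≡ (ℕ.<⇒≢ x<m)

toℕ-ζ-last : ∀ {m} (x : Fin (suc m)) → toℕ x ≡ m → toℕ (ζ x) ≡ 0
toℕ-ζ-last x x≡m with dropLast x | dropLast-view x
... | _ | kept j j≡ = contradiction (trans j≡ x≡m) (ℕ.<⇒≢ (toℕ<n j))
... | _ | dropped _ = refl

last? : ∀ {m} (x : Fin (suc m)) → toℕ x ≡ m ⊎ toℕ x ℕ.< m
last? x with ℕ.m≤n⇒m<n∨m≡n (ℕ.≤-pred (toℕ<n x))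
... | inj₁ x<m = inj₂ x<m
... | inj₂ x≡m = inj₁ x≡m

ζ-injective : ∀ {n} {x y : Fin n} → ζ x ≡ ζ y → x ≡ y
ζ-injective {suc m} {x} {y} eq with last? x | last? y
... | inj₁ x≡ | inj₁ y≡ = toℕ-injective (trans x≡ (sym y≡))
... | inj₁ x≡ | inj₂ y< = contradiction (trans (sym (toℕ-ζ-last x x≡)) (trans (cong toℕ eq) (toℕ-ζ-suc y y<))) λ ()
... | inj₂ x< | inj₁ y≡ = contradiction (trans (sym (toℕ-ζ-last y y≡)) (trans (cong toℕ (sym eq)) (toℕ-ζ-suc x x<))) λ ()
... | inj₂ x< | inj₂ y< = toℕ-injective (ℕ.suc-injective (trans (sym (toℕ-ζ-suc x x<)) (trans (cong toℕ eq) (toℕ-ζ-suc y y<))))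

abstract
  ζₚ : ∀ n → Permutation′ n
  ζₚ n = proj₁ (injective⇒permutation ζ ζ-injective)

  ζₚ≐ζ : ∀ {n} → ζₚ n ≐ ζ
  ζₚ≐ζ = proj₂ (injective⇒permutation ζ ζ-injective)

toℕ-ζ : ∀ {m} (x : Fin (suc m)) → toℕ (ζ x) ≡ cyc 0 m (toℕ x)
toℕ-ζ {m} x with last? x
... | inj₁ x≡m = trans (toℕ-ζ-last x x≡m) (sym (trans (cong (cyc 0 m) x≡m) (cyc-end z≤n)))
... | inj₂ x<m = trans (toℕ-ζ-suc x x<m) (sym (cyc-mid z≤n x<m))

module _ {m : ℕ} {R : BlockRel (suc m)} (eqv : IsEquivalence R) where

  autζ⇒presN : AutF R ζ → PresN R (cyc 0 m)
  autζ⇒presN aut = pres⇒presN toℕ-ζ (autF⇒pres eqv ζ-injective aut)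

  presN⇒autζ : PresN R (cyc 0 m) → AutF R ζ
  presN⇒autζ pres = pres⇒autF eqv (ζₚ _ ⟨$⟩ˡ_) (λ x → trans (sym (ζₚ≐ζ _)) (inverseʳ (ζₚ _))) λ x y → mk⇔
    (λ r → ℕRel⁻ (subst₂ (ℕRel R) (sym (toℕ-ζ x)) (sym (toℕ-ζ y)) (to (pres (toℕ<n x) (toℕ<n y)) (ℕRel⁺ r))))
    (λ r → ℕRel⁻ (from (pres (toℕ<n x) (toℕ<n y)) (subst₂ (ℕRel R) (toℕ-ζ x) (toℕ-ζ y) (ℕRel⁺ r))))

-- Comp and the permutations fixing every block of Π^(i)

sp⇒ : ∀ {n} {Q : BlockRel n} → IsEquivalence Q → ∀ π → SP Q π → ∀ x → Q x (π ⟨$⟩ʳ x)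
sp⇒ eqv π sp x = IsEquivalence.sym eqv (to (sp x _) (x , IsEquivalence.refl eqv , refl))

⇒sp : ∀ {n} {Q : BlockRel n} → IsEquivalence Q → ∀ π → (∀ x → Q x (π ⟨$⟩ʳ x)) → SP Q π
⇒sp {Q = Q} eqv π h b x = mk⇔
  (λ { (y , q , refl) → E.trans (E.sym (h y)) q })
  (λ q → π ⟨$⟩ˡ x , E.trans (subst (Q (π ⟨$⟩ˡ x)) (inverseʳ π) (h _)) q , inverseʳ π)
  where module E = IsEquivalence eqv

module _ {n : ℕ} {R : BlockRel n} (eqv : IsEquivalence R) where
  private module E = IsEquivalence eqv

  -- A pattern `σ` moves each point within its block of `R`: if it crosses the boundary c, then `T`
  -- crosses the boundary ι c. Since ι c exceeds c by at most i + 1, that boundary is governed by c,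
  -- and c ~ c + 1 follows.
  sp⇒comp : ∀ i (T : Permutation′ (suc i + n)) → SP (iter (suc i) R) T → Comp (suc i + n) (Aut R) T
  sp⇒comp i T sp ι inc σ iso = pres⇒aut eqv σ λ x y → mk⇔
    (λ r → E.trans (E.sym (moves x)) (E.trans r (moves y)))
    (λ r → E.trans (moves x) (E.trans r (E.sym (moves y))))
    where
    T-block : ∀ c′ s → suc c′ ℕ.< n → s ℕ.≤ suc i → ∀ y → Crosses (c′ + s) (toℕ y) (toℕ (T ⟨$⟩ʳ y)) → ℕRel R c′ (suc c′)
    T-block c′ s c′<n s≤ y cr = to (joints-iter eqv i y (T ⟨$⟩ʳ y)) (sp⇒ (joints⇒isEquivalence (joints-iter eqv i)) T sp y) _ cr c′ s c′<n s≤ refl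

    -- If T kept [0, ι c] in place as a set, then σ would keep [0, c].
    joint : ∀ j (c : Fin n) → suc (toℕ c) ℕ.< n → Crosses (toℕ c) (toℕ j) (toℕ (σ ⟨$⟩ʳ j)) → ℕRel R (toℕ c) (suc (toℕ c))
    joint j c c<n cr with ℕ.m≤n⇒∃[o]m+o≡n (strictInc⇒≤ inc c)
    ... | s , eq with any? (λ y → ((toℕ y ℕ.≤? toℕ (ι c)) ×-dec (toℕ (ι c) ℕ.<? toℕ (T ⟨$⟩ʳ y)))
                             ⊎-dec ((toℕ (T ⟨$⟩ʳ y) ℕ.≤? toℕ (ι c)) ×-dec (toℕ (ι c) ℕ.<? toℕ y)))
    ... | yes (y , cy) = T-block (toℕ c) s c<n s≤ y (subst (λ C → Crosses C (toℕ y) (toℕ (T ⟨$⟩ʳ y))) (sym eq) cy)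
      where
      s≤ : s ℕ.≤ suc i
      s≤ = ℕ.+-cancelˡ-≤ (toℕ c) _ _ (subst₂ ℕ._≤_ (sym eq) (ℕ.+-comm (suc i) (toℕ c))
        (ℕ.+-cancelʳ-≤ n _ _ (subst (toℕ (ι c) + n ℕ.≤_) shuffle (strictInc⇒+≤ inc c))))
        where
        shuffle : suc i + n + toℕ c ≡ suc i + toℕ c + n
        shuffle = trans (ℕ.+-assoc (suc i) n (toℕ c)) (trans (cong (suc i +_) (ℕ.+-comm n (toℕ c))) (sym (ℕ.+-assoc (suc i) (toℕ c) n)))
    ... | no none = contradiction cr λ where
        (inj₁ (j≤c , c<σj)) → ℕ.<⇒≱ (initial-reflect (flip σ) (σ⁻¹-keeps j≤c c<σj) (σ ⟨$⟩ʳ j)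
            (subst (λ z → toℕ z ℕ.< suc (toℕ c)) (sym (inverseˡ σ)) (s≤s j≤c))) c<σj
        (inj₂ (σj≤c , c<j)) → ℕ.<⇒≱ (initial-reflect σ (λ k k≤c → s≤s (ℕ.<⇒≤ (ℕ.<-≤-trans (separated k j (ℕ.≤-pred k≤c) c<j) σj≤c))) j (s≤s σj≤c)) c<j
      where
      ι-≤ : ∀ k → toℕ k ℕ.≤ toℕ c → toℕ (ι k) ℕ.≤ toℕ (ι c)
      ι-≤ k k≤c with ℕ.m≤n⇒m<n∨m≡n k≤c
      ... | inj₁ k<c = ℕ.<⇒≤ (inc k c k<c)
      ... | inj₂ k≡c = ℕ.≤-reflexive (cong (toℕ ∘ ι) (toℕ-injective k≡c))
      separated : ∀ k k′ → toℕ k ℕ.≤ toℕ c → toℕ c ℕ.< toℕ k′ → (σ ⟨$⟩ʳ k) < (σ ⟨$⟩ʳ k′)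
      separated k k′ k≤c c<k′ = from (iso k k′) (ℕ.≤-<-trans
        (ℕ.≮⇒≥ λ lt → none (ι k , inj₁ (ι-≤ k k≤c , lt)))
        (ℕ.≰⇒> λ le → none (ι k′ , inj₂ (le , inc c k′ c<k′))))
      σ⁻¹-keeps : toℕ j ℕ.≤ toℕ c → toℕ c ℕ.< toℕ (σ ⟨$⟩ʳ j) → ∀ w → toℕ w ℕ.< suc (toℕ c) → toℕ (σ ⟨$⟩ˡ w) ℕ.< suc (toℕ c)
      σ⁻¹-keeps j≤c c<σj w (s≤s w≤c) = s≤s (ℕ.≮⇒≥ λ c<k → ℕ.<-asym c<σj
        (ℕ.<-≤-trans (separated j (σ ⟨$⟩ˡ w) j≤c c<k) (subst (λ z → toℕ z ℕ.≤ toℕ c) (sym (inverseʳ σ)) w≤c)))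

    moves : ∀ j → R j (σ ⟨$⟩ʳ j)
    moves j = ℕRel⁻ (chain eqv (toℕ<n j) (toℕ<n (σ ⟨$⟩ʳ j)) λ c cr c<n →
      let c<n′ = ℕ.<-trans (ℕ.n<1+n c) c<n ; c≡ = toℕ-fromℕ< c<n′ in
      subst (λ z → ℕRel R z (suc z)) c≡ (joint j (fromℕ< c<n′) (subst (λ z → suc z ℕ.< n) (sym c≡) c<n)
        (subst (λ z → Crosses z (toℕ j) (toℕ (σ ⟨$⟩ʳ j))) (sym c≡) cr)))

  -- Every pattern of a reversal is a reversal.
  comp-δ : AutF R δ → ∀ {m} {π : Permutation′ m} → π ≐ δ → Comp m (Aut R) π
  comp-δ aut {π = π} π≐δ ι inc σ iso = autF-ext eqv (λ x → sym (orderIso-unique reverse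
    (λ j k → mk⇔ (from (pattern-δ {π = π} π≐δ inc j k) ∘ to (iso j k)) (from (iso j k) ∘ to (pattern-δ {π = π} π≐δ inc j k))) x)) aut

  -- `Comp m (Aut R)` inherits the group structure of `Aut R`, so it is enough to treat generators.
  comp-gen : ∀ {m} {G : Permutation′ m → Set} → (∀ {π} → G π → Comp m (Aut R) π) → ∀ {π} → Gen G π → Comp m (Aut R) π
  comp-gen g (gen x) = g x
  comp-gen g unit = comp-id (λ {ρ} → aut-id eqv {ρ})
  comp-gen g (comp {σ} {τ} p q) = comp-∘ (λ {σ} {τ} {ρ} → aut-∘ eqv {σ} {τ} {ρ}) {σ} {τ} (comp-gen g p) (comp-gen g q)
  comp-gen g (inv {σ} p) = comp-flip (aut-flip eqv) {σ} (comp-gen g p)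
  comp-gen g (ext {σ} {τ} e p) = comp-ext {S = Aut R} {σ} {τ} e (comp-gen g p)

  module _ (mate : ∀ a → ∃ λ b → b ≢ a × R a b) {I : ℕ} (0<I : 0 ℕ.< I) (¬ζ : ¬ AutF R ζ)
           (τ : Permutation′ (suc I + n)) (τ∈ : Comp (suc I + n) (Aut R) τ) where

    private
      jump : ∀ {u v c s} → Adjacent (toℕ (τ ⟨$⟩ˡ u)) (toℕ (τ ⟨$⟩ˡ v)) → suc c ℕ.< n → s ℕ.≤ I →
        toℕ u ℕ.≤ c + s → suc (suc (c + s)) ℕ.≤ toℕ v → ℕRel R c (suc c)
      jump {u} {v} adj c<n s≤I u≤ ≤v with transition eqv mate 0<I (flip τ) (comp-flip (aut-flip eqv) {τ} τ∈) {u} {v} adj c<n s≤I u≤ ≤v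
      ... | inj₁ r = r
      ... | inj₂ (_ , _ , pres) = contradiction (ζ-aut eqv pres) ¬ζ
        where
        ζ-aut : ∀ {n} {R : BlockRel n} → IsEquivalence R → PresN R (cyc 0 (ℕ.pred n)) → AutF R ζ
        ζ-aut {zero} _ _ ()
        ζ-aut {suc n} eqv pres = presN⇒autζ eqv pres

      sp : (T : Permutation′ (suc I + n)) → (∀ {c s} → suc c ℕ.< n → s ℕ.≤ suc I → ∀ x → Crosses (c + s) (toℕ x) (toℕ (T ⟨$⟩ʳ x)) → ℕRel R c (suc c)) →
        SP (iter (suc I) R) T
      sp T h = ⇒sp (joints⇒isEquivalence (joints-iter eqv I)) T λ x → from (joints-iter eqv I x (T ⟨$⟩ʳ x)) λ { _ cr c′ s c′<n s≤ refl → h c′<n s≤ x cr }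

    -- If the value 0 comes after the largest one, reading `τ` backwards exchanges the two and keeps
    -- neighbours adjacent.
    comp⇒sp⊎sp : SP (iter (suc I) R) τ ⊎ SP (iter (suc I) R) (reverse ∘ₚ τ)
    comp⇒sp⊎sp with <-cmp (τ ⟨$⟩ˡ zero) (τ ⟨$⟩ˡ fromℕ (I + n))
    ... | tri< lt _ _ = inj₁ (sp τ (crosses⇒rel τ (λ {u} {v} → jump {u} {v}) lt))
    ... | tri≈ _ eq _ = contradiction (trans (cong toℕ (⟨$⟩ʳ-injective (flip τ) eq)) (toℕ-fromℕ (I + n))) (ℕ.<⇒≢ (ℕ.<-≤-trans 0<I (ℕ.m≤m+n I n)))
    ... | tri> _ _ gt = inj₂ (sp (reverse ∘ₚ τ) (crosses⇒rel (reverse ∘ₚ τ) (λ {u} {v} adj → jump {u} {v} (opposite-adjacent⁻ adj)) (opposite-anti gt)))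

    -- Both `reverse ∘ₚ τ` and `τ` lie in the group Comp, hence so does their quotient, the
    -- reversal. Its pattern at the last n indices is δ.
    sp-reverse⇒autδ : SP (iter (suc I) R) (reverse ∘ₚ τ) → AutF R δ
    sp-reverse⇒autδ sp = rev∈ (suc I ↑ʳ_) inc reverse (pattern-δ {π = reverse} (λ _ → refl) inc)
      where
      inc : StrictInc {n} (suc I ↑ʳ_)
      inc j k j<k = subst₂ ℕ._<_ (sym (toℕ-↑ʳ (suc I) j)) (sym (toℕ-↑ʳ (suc I) k)) (ℕ.+-monoʳ-< (suc I) j<k)
      rev∈ : Comp (suc I + n) (Aut R) reverse
      rev∈ = comp-ext {S = Aut R} {(reverse ∘ₚ τ) ∘ₚ flip τ} {reverse} (λ x → inverseˡ τ)
        (comp-∘ (λ {σ} {τ} {ρ} → aut-∘ eqv {σ} {τ} {ρ}) {reverse ∘ₚ τ} {flip τ} (sp⇒comp I (reverse ∘ₚ τ) sp) (comp-flip (aut-flip eqv) {τ} τ∈))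

-- The dihedral case

ζ-last : ∀ M → ζ (fromℕ M) ≡ zero
ζ-last M = toℕ-injective (toℕ-ζ-last (fromℕ M) (toℕ-fromℕ M))

-- The dihedral relation, through which ζδ turns a step forwards along the cycle into a step
-- backwards.
ζ-δ-ζ : ∀ {M} (x : Fin (suc M)) → ζ (δ (ζ x)) ≡ δ x
ζ-δ-ζ {M} x with last? x
... | inj₁ x≡ = trans (cong (ζ ∘ δ) ζx≡0) (trans (ζ-last M) (toℕ-injective (sym (ℕ.+-cancelˡ-≡ M _ _
      (trans (cong (_+ toℕ (opposite x)) (sym x≡)) (trans (ℕ.suc-injective (toℕ-opposite x)) (sym (ℕ.+-identityʳ M))))))))
  where
  ζx≡0 : ζ x ≡ zero
  ζx≡0 = toℕ-injective (toℕ-ζ-last x x≡)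
... | inj₂ x< = toℕ-injective (trans (toℕ-ζ-suc (δ (ζ x)) δζ<) (ℕ.+-cancelˡ-≡ (toℕ x) _ _
      (trans (ℕ.+-suc (toℕ x) _) (trans sum (sym (ℕ.suc-injective (toℕ-opposite x)))))))
  where
  sum : suc (toℕ x) + toℕ (δ (ζ x)) ≡ M
  sum = trans (cong (_+ toℕ (δ (ζ x))) (sym (toℕ-ζ-suc x x<))) (ℕ.suc-injective (toℕ-opposite (ζ x)))
  δζ< : toℕ (δ (ζ x)) ℕ.< M
  δζ< = subst (suc (toℕ (δ (ζ x))) ℕ.≤_) sum (s≤s (ℕ.m≤n+m _ (toℕ x)))

CyclicallyAdjacent : ∀ {n} → Fin n → Fin n → Set
CyclicallyAdjacent x y = y ≡ ζ x ⊎ x ≡ ζ y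

-- The sequence of values of `τ` is a Hamiltonian path in the cycle graph.
CycleWalk : ∀ {n} → Permutation′ n → Set
CycleWalk τ = ∀ x y → toℕ y ≡ suc (toℕ x) → CyclicallyAdjacent (τ ⟨$⟩ʳ x) (τ ⟨$⟩ʳ y)

ζ-suc : ∀ {M} {x y : Fin (suc M)} → toℕ y ≡ suc (toℕ x) → ζ x ≡ y
ζ-suc {M} {x} {y} y≡ = toℕ-injective (trans (toℕ-ζ-suc x (ℕ.≤-pred (subst (ℕ._≤ suc M) (cong suc y≡) (toℕ<n y)))) (sym y≡))

-- Of the two cyclic neighbours of the current value, one was visited in the step before, so the
-- walk can only go on.
cycleWalk-identity : ∀ {M} (τ : Permutation′ (suc (suc M))) → CycleWalk τ →
  τ ⟨$⟩ʳ zero ≡ zero → τ ⟨$⟩ʳ suc zero ≡ suc zero → ∀ x → τ ⟨$⟩ʳ x ≡ x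
cycleWalk-identity {M} τ cw τ0 τ1 w = go (toℕ w) w refl
  where
  go : ∀ k x → toℕ x ≡ k → τ ⟨$⟩ʳ x ≡ x
  go zero zero _ = τ0
  go (suc zero) (suc zero) _ = τ1
  go (suc (suc k)) z z≡ = third (go k x x≡) (go (suc k) y y≡) (cw y z (trans z≡ (cong suc (sym y≡))))
    where
    k+1<N : suc k ℕ.< suc (suc M)
    k+1<N = ℕ.<-trans (ℕ.n<1+n _) (subst (ℕ._< suc (suc M)) z≡ (toℕ<n z))
    k<N = ℕ.<-trans (ℕ.n<1+n k) k+1<N
    x = fromℕ< k<N
    y = fromℕ< k+1<N
    x≡ : toℕ x ≡ k
    x≡ = toℕ-fromℕ< k<N
    y≡ : toℕ y ≡ suc k
    y≡ = toℕ-fromℕ< k+1<N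
    ζy : ζ y ≡ z
    ζy = ζ-suc (trans z≡ (cong suc (sym y≡)))
    ζx : ζ x ≡ y
    ζx = ζ-suc (trans y≡ (cong suc (sym x≡)))
    third : τ ⟨$⟩ʳ x ≡ x → τ ⟨$⟩ʳ y ≡ y → CyclicallyAdjacent (τ ⟨$⟩ʳ y) (τ ⟨$⟩ʳ z) → τ ⟨$⟩ʳ z ≡ z
    third τx τy (inj₁ eq) = trans eq (trans (cong ζ τy) ζy)
    third τx τy (inj₂ eq) = contradiction (trans (sym x≡) (trans (cong toℕ (⟨$⟩ʳ-injective τ (trans τx (ζ-injective
      (trans ζx (trans (sym τy) eq)))))) z≡)) (ℕ.<⇒≢ (ℕ.m≤n⇒m≤1+n (ℕ.n<1+n k)))

ζₚ-flip : ∀ {n} (x : Fin n) → ζ (ζₚ n ⟨$⟩ˡ x) ≡ x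
ζₚ-flip x = trans (sym (ζₚ≐ζ _)) (inverseʳ (ζₚ _))

-- Rotate the walk so that it starts at 0; it then goes once around the cycle, in one of the two directions.
cycleWalk⇒D : ∀ {M} (τ : Permutation′ (suc (suc M))) → CycleWalk τ → D (suc (suc M)) τ
cycleWalk⇒D {M} τ cw = rotate (toℕ (τ ⟨$⟩ʳ zero)) τ cw refl
  where
  N = suc (suc M)

  atZero : ∀ τ → CycleWalk τ → τ ⟨$⟩ʳ zero ≡ zero → D N τ
  atZero τ cw τ0 with cw zero (suc zero) refl
  ... | inj₁ τ1 = ext (λ x → sym (cycleWalk-identity τ cw τ0 (trans τ1 (trans (cong ζ τ0) (ζ-suc refl))) x)) unit
  ... | inj₂ 0≡ = ext {σ = τ′ ∘ₚ flip (reverse ∘ₚ ζₚ N)} (λ x → inverseˡ (reverse ∘ₚ ζₚ N))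
      (comp {σ = τ′} (ext {σ = id} (λ x → sym (cycleWalk-identity τ′ cw′ τ′0 τ′1 x)) unit)
            (inv {σ = reverse ∘ₚ ζₚ N} (comp {σ = reverse} {τ = ζₚ N} (gen (inj₂ λ _ → refl)) (gen (inj₁ ζₚ≐ζ)))))
    where
    -- The walk runs backwards. `reverse ∘ₚ ζₚ N` is the reflection x ↦ -x modulo N, which fixes 0
    -- and turns the walk round.
    τ′ = τ ∘ₚ (reverse ∘ₚ ζₚ N)
    τ′≡ : ∀ x → τ′ ⟨$⟩ʳ x ≡ ζ (δ (τ ⟨$⟩ʳ x))
    τ′≡ x = ζₚ≐ζ (δ (τ ⟨$⟩ʳ x))
    τ1≡last : τ ⟨$⟩ʳ suc zero ≡ fromℕ (suc M)
    τ1≡last = ζ-injective (trans (sym 0≡) (trans τ0 (sym (ζ-last (suc M)))))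
    τ′0 : τ′ ⟨$⟩ʳ zero ≡ zero
    τ′0 = trans (τ′≡ zero) (trans (cong (ζ ∘ δ) τ0) (ζ-last (suc M)))
    τ′1 : τ′ ⟨$⟩ʳ suc zero ≡ suc zero
    τ′1 = trans (τ′≡ (suc zero)) (trans (cong (ζ ∘ δ) τ1≡last) (trans (cong ζ (opposite-involutive {suc (suc M)} zero)) (ζ-suc refl)))
    flipped : ∀ {a b} → CyclicallyAdjacent a b → CyclicallyAdjacent (ζ (δ a)) (ζ (δ b))
    flipped {a} {b} (inj₁ refl) = inj₂ (cong ζ (sym (ζ-δ-ζ a)))
    flipped {a} {b} (inj₂ refl) = inj₁ (cong ζ (sym (ζ-δ-ζ b)))
    cw′ : CycleWalk τ′
    cw′ x y y≡ = subst₂ CyclicallyAdjacent (sym (τ′≡ x)) (sym (τ′≡ y)) (flipped (cw x y y≡))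

  rotate : ∀ k τ → CycleWalk τ → toℕ (τ ⟨$⟩ʳ zero) ≡ k → D N τ
  rotate zero τ cw τ0 = atZero τ cw (toℕ-injective τ0)
  rotate (suc k) τ cw τ0 = ext {σ = (τ ∘ₚ flip (ζₚ N)) ∘ₚ ζₚ N} (λ x → inverseʳ (ζₚ N))
      (comp {σ = τ ∘ₚ flip (ζₚ N)} {τ = ζₚ N} (rotate k (τ ∘ₚ flip (ζₚ N)) cw′ start) (gen (inj₁ ζₚ≐ζ)))
    where
    back : ∀ {a b} → CyclicallyAdjacent a b → CyclicallyAdjacent (ζₚ N ⟨$⟩ˡ a) (ζₚ N ⟨$⟩ˡ b)
    back {a} {b} (inj₁ eq) = inj₁ (ζ-injective (trans (ζₚ-flip b) (trans eq (cong ζ (sym (ζₚ-flip a))))))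
    back {a} {b} (inj₂ eq) = inj₂ (ζ-injective (trans (ζₚ-flip a) (trans eq (cong ζ (sym (ζₚ-flip b))))))
    cw′ : CycleWalk (τ ∘ₚ flip (ζₚ N))
    cw′ x y y≡ = back (cw x y y≡)
    k<N : k ℕ.< N
    k<N = ℕ.<-trans (ℕ.n<1+n k) (subst (ℕ._< N) τ0 (toℕ<n (τ ⟨$⟩ʳ zero)))
    start : toℕ ((τ ∘ₚ flip (ζₚ N)) ⟨$⟩ʳ zero) ≡ k
    start = trans (cong toℕ (ζ-injective (trans (ζₚ-flip (τ ⟨$⟩ʳ zero)) (sym (ζ-suc (trans τ0 (cong suc (sym (toℕ-fromℕ< k<N)))))))))
      (toℕ-fromℕ< k<N)

module _ {m : ℕ} {R : BlockRel (suc m)} (eqv : IsEquivalence R) (autζ : AutF R ζ) where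

  -- Up to m the k-th iterate of ζ is translation by k, without wrapping around.
  ζ-shift : ∀ k {x y} → k + x ℕ.≤ m → k + y ℕ.≤ m → (ℕRel R x y ⇔ ℕRel R (k + x) (k + y))
  ζ-shift zero _ _ = mk⇔ (λ r → r) (λ r → r)
  ζ-shift (suc k) {x} {y} kx ky = mk⇔
    (subst₂ (ℕRel R) (cyc-mid z≤n kx) (cyc-mid z≤n ky) ∘ to step ∘ to rec)
    (from rec ∘ from step ∘ subst₂ (ℕRel R) (sym (cyc-mid z≤n kx)) (sym (cyc-mid z≤n ky)))
    where
    rec = ζ-shift k (ℕ.<⇒≤ kx) (ℕ.<⇒≤ ky)
    step = autζ⇒presN eqv autζ (ℕ.m≤n⇒m≤1+n kx) (ℕ.m≤n⇒m≤1+n ky)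

  -- Opposite pairs {x, y} and {δ y, δ x} differ by a translation.
  autζ⇒autδ : AutF R δ
  autζ⇒autδ = pres⇒autF eqv δ opposite-involutive λ x y → mk⇔ (reflected x y)
    (λ r → subst₂ R (opposite-involutive x) (opposite-involutive y) (reflected (δ x) (δ y) r))
    where
    module E = IsEquivalence eqv
    x+δx : ∀ x → toℕ x + toℕ (δ x) ≡ m
    x+δx x = ℕ.suc-injective (toℕ-opposite x)

    translate : ∀ {x y : Fin (suc m)} {k} → k + toℕ x ≡ toℕ (δ y) → k + toℕ y ≡ toℕ (δ x)
    translate {x} {y} {k} eq = ℕ.+-cancelˡ-≡ (toℕ x) _ _ (begin
      toℕ x + (k + toℕ y)  ≡⟨ ℕ.+-assoc (toℕ x) k (toℕ y) ⟨
      toℕ x + k + toℕ y    ≡⟨ cong (_+ toℕ y) (trans (ℕ.+-comm (toℕ x) k) eq) ⟩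
      toℕ (δ y) + toℕ y    ≡⟨ ℕ.+-comm (toℕ (δ y)) (toℕ y) ⟩
      toℕ y + toℕ (δ y)    ≡⟨ x+δx y ⟩
      m                    ≡⟨ x+δx x ⟨
      toℕ x + toℕ (δ x)    ∎)
      where open ≡-Reasoning

    shifted : ∀ {x y : Fin (suc m)} k → k + toℕ x ≡ toℕ (δ y) → (R x y ⇔ R (δ y) (δ x))
    shifted {x} {y} k eq = mk⇔
      (λ r → ℕRel⁻ (subst₂ (ℕRel R) eq eq′ (to sh (ℕRel⁺ r))))
      (λ r → ℕRel⁻ (from sh (subst₂ (ℕRel R) (sym eq) (sym eq′) (ℕRel⁺ r))))
      where
      eq′ = translate {x} {y} {k} eq
      sh = ζ-shift k (subst (ℕ._≤ m) (sym eq) (ℕ.≤-pred (toℕ<n (δ y)))) (subst (ℕ._≤ m) (sym eq′) (ℕ.≤-pred (toℕ<n (δ x))))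

    reflected : ∀ x y → R x y → R (δ x) (δ y)
    reflected x y r with ℕ.≤-total (toℕ x) (toℕ (δ y))
    ... | inj₁ x≤ = E.sym (to (shifted (toℕ (δ y) ℕ.∸ toℕ x) (ℕ.m∸n+n≡m x≤)) r)
    ... | inj₂ ≤x = E.sym (from (shifted {δ y} {δ x} (toℕ x ℕ.∸ toℕ (δ y)) (trans (ℕ.m∸n+n≡m ≤x) (cong toℕ (sym (opposite-involutive x)))))
      (subst₂ R (sym (opposite-involutive x)) (sym (opposite-involutive y)) r))

  -- A pattern of the long cycle is the long cycle or the identity, according to whether it uses the last index.
  comp-ζ : ∀ {M} {π : Permutation′ (suc M)} → π ≐ ζ → Comp (suc M) (Aut R) π
  comp-ζ {M} {π} π≐ζ ι inc σ iso with last? (ι (fromℕ m))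
  ... | inj₂ ι-last< = aut-id eqv {σ} λ x → sym (orderIso-unique id (λ j k → mk⇔
        (λ lt → strictInc-reflects inc j k (ℕ.≤-pred (subst₂ ℕ._<_ (ζι j) (ζι k) (to (iso j k) lt))))
        (λ lt → from (iso j k) (subst₂ ℕ._<_ (sym (ζι j)) (sym (ζι k)) (s≤s (inc j k lt))))) x)
    where
    ι≤ : ∀ j → toℕ (ι j) ℕ.≤ toℕ (ι (fromℕ m))
    ι≤ j with last? j
    ... | inj₁ j≡m = ℕ.≤-reflexive (cong (toℕ ∘ ι) (toℕ-injective (trans j≡m (sym (toℕ-fromℕ m)))))
    ... | inj₂ j<m = ℕ.<⇒≤ (inc j (fromℕ m) (subst (toℕ j ℕ.<_) (sym (toℕ-fromℕ m)) j<m))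
    ζι : ∀ j → toℕ (π ⟨$⟩ʳ ι j) ≡ suc (toℕ (ι j))
    ζι j = trans (cong toℕ (π≐ζ (ι j))) (toℕ-ζ-suc (ι j) (ℕ.≤-<-trans (ι≤ j) ι-last<))
  ... | inj₁ ι-last≡ = autF-ext eqv (λ x → sym (trans (orderIso-unique (ζₚ (suc m)) (λ j k → mk⇔
        (from (ζ-iso j k) ∘ to (iso j k)) (from (iso j k) ∘ to (ζ-iso j k))) x) (ζₚ≐ζ x))) autζ
    where
    ιζ : ∀ j → (toℕ (ζₚ (suc m) ⟨$⟩ʳ j) ≡ 0 × toℕ (π ⟨$⟩ʳ ι j) ≡ 0)
             ⊎ (toℕ (ζₚ (suc m) ⟨$⟩ʳ j) ≡ suc (toℕ j) × toℕ (π ⟨$⟩ʳ ι j) ≡ suc (toℕ (ι j)))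
    ιζ j with last? j
    ... | inj₁ j≡m = inj₁ (trans (cong toℕ (ζₚ≐ζ j)) (toℕ-ζ-last j j≡m) , trans (cong toℕ (π≐ζ (ι j))) (toℕ-ζ-last (ι j)
          (trans (cong (toℕ ∘ ι) (toℕ-injective (trans j≡m (sym (toℕ-fromℕ m))))) ι-last≡)))
    ... | inj₂ j<m = inj₂ (trans (cong toℕ (ζₚ≐ζ j)) (toℕ-ζ-suc j j<m) , trans (cong toℕ (π≐ζ (ι j))) (toℕ-ζ-suc (ι j)
          (subst (toℕ (ι j) ℕ.<_) ι-last≡ (inc j (fromℕ m) (subst (toℕ j ℕ.<_) (sym (toℕ-fromℕ m)) j<m)))))
    ζ-iso : ∀ j k → (ζₚ (suc m) ⟨$⟩ʳ j) < (ζₚ (suc m) ⟨$⟩ʳ k) ⇔ (π ⟨$⟩ʳ ι j) < (π ⟨$⟩ʳ ι k)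
    ζ-iso j k with ιζ j | ιζ k
    ... | inj₁ (a , b) | inj₁ (c , d) rewrite a | b | c | d = mk⇔ (λ ()) (λ ())
    ... | inj₁ (a , b) | inj₂ (c , d) rewrite a | b | c | d = mk⇔ (λ _ → s≤s z≤n) (λ _ → s≤s z≤n)
    ... | inj₂ (a , b) | inj₁ (c , d) rewrite a | b | c | d = mk⇔ (λ ()) (λ ())
    ... | inj₂ (a , b) | inj₂ (c , d) rewrite a | b | c | d = mk⇔
      (λ { (s≤s lt) → s≤s (inc j k lt) }) (λ { (s≤s lt) → s≤s (strictInc-reflects inc j k lt) })

  D⇒comp : ∀ {M} {π : Permutation′ (suc M)} → D (suc M) π → Comp (suc M) (Aut R) π
  D⇒comp {M} = comp-gen eqv λ { {π} (inj₁ π≐ζ) → comp-ζ {π = π} π≐ζ ; {π} (inj₂ π≐δ) → comp-δ eqv autζ⇒autδ {π = π} π≐δ }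

module _ {k : ℕ} {R : BlockRel (suc (suc k))} (eqv : IsEquivalence R) (mate : ∀ a → ∃ λ b → b ≢ a × R a b)
         (apart : ∃ λ a → ∃ λ b → ¬ R a b) (autζ : AutF R ζ) where

  private
    n : ℕ
    n = suc (suc k)

    -- Translations by powers of ζ would carry one related pair of neighbours to all others, leaving
    -- a single block.
    noJoint : ∀ c → suc c ℕ.< n → ¬ ℕRel R c (suc c)
    noJoint c c<n r = let a , b , ¬r = apart in
      ¬r (ℕRel⁻ (chain eqv (toℕ<n a) (toℕ<n b) λ d _ d<n → subst₂ (ℕRel R) (ℕ.+-identityʳ d) (ℕ.+-comm d 1) (to (sh d d<n)
        (from (sh c c<n) (subst₂ (ℕRel R) (sym (ℕ.+-identityʳ c)) (ℕ.+-comm 1 c) r)))))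
      where
      sh : ∀ d → suc d ℕ.< n → ℕRel R 0 1 ⇔ ℕRel R (d + 0) (d + 1)
      sh d d<n = ζ-shift eqv autζ d (subst (ℕ._≤ suc k) (sym (ℕ.+-identityʳ d)) (ℕ.<⇒≤ (ℕ.≤-pred d<n)))
        (subst (ℕ._≤ suc k) (ℕ.+-comm 1 d) (ℕ.≤-pred d<n))

  -- No two neighbours are related, so only the exceptional case of `transition` is left: values at
  -- consecutive positions either differ by one or are the two extremes.
  comp⇒D : ∀ {I} → 0 ℕ.< I → (τ : Permutation′ (suc I + n)) → Comp (suc I + n) (Aut R) τ → D (suc I + n) τ
  comp⇒D {suc I′} 0<I τ τ∈ = cycleWalk⇒D τ walk
    where
    I = suc I′
    close : ∀ {u v : Fin (suc I + n)} → Adjacent (toℕ (τ ⟨$⟩ˡ u)) (toℕ (τ ⟨$⟩ˡ v)) → u < v → CyclicallyAdjacent u v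
    close {u} {v} adj u<v with ℕ.m≤n⇒m<n∨m≡n u<v
    ... | inj₂ v≡ = inj₁ (sym (ζ-suc (sym v≡)))
    ... | inj₁ u+1<v = far (toℕ u ℕ.≤? k)
      where
      use : ∀ {c s} → suc c ℕ.< n → s ℕ.≤ I → toℕ u ≡ c + s → CyclicallyAdjacent u v
      use {c} {s} c<n s≤I u≡ with transition eqv mate 0<I (flip τ) (comp-flip (aut-flip eqv) {τ} τ∈) {u} {v} adj c<n s≤I
        (ℕ.≤-reflexive u≡) (subst (λ z → suc (suc z) ℕ.≤ toℕ v) u≡ u+1<v)
      ... | inj₁ r = contradiction r (noJoint c c<n)
      ... | inj₂ (u≡0 , v≡ , _) = inj₂ (toℕ-injective (trans u≡0 (sym (toℕ-ζ-last v v≡))))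
      -- Every `u` here has the form c + s: s = 0 as long as u ≤ n - 2, and c = n - 2 beyond that,
      -- where u + 2 ≤ v ≤ I + n gives s ≤ I.
      far : Dec (toℕ u ℕ.≤ k) → CyclicallyAdjacent u v
      far (yes u≤k) = use (s≤s (s≤s u≤k)) z≤n (sym (ℕ.+-identityʳ (toℕ u)))
      far (no u≰k) with ℕ.m≤n⇒∃[o]m+o≡n (ℕ.<⇒≤ (ℕ.≰⇒> u≰k))
      ... | s , eq = use ℕ.≤-refl (ℕ.+-cancelˡ-≤ n _ _ (subst₂ ℕ._≤_ (cong (2 +_) (sym eq)) (ℕ.+-comm I n)
              (ℕ.≤-trans u+1<v (ℕ.≤-pred (toℕ<n v))))) (sym eq)
    walk : ∀ x y → toℕ y ≡ suc (toℕ x) → CyclicallyAdjacent (τ ⟨$⟩ʳ x) (τ ⟨$⟩ʳ y)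
    walk x y y≡ with <-cmp (τ ⟨$⟩ʳ x) (τ ⟨$⟩ʳ y) | subst₂ (λ a b → Adjacent (toℕ a) (toℕ b)) (sym (inverseˡ τ)) (sym (inverseˡ τ)) (inj₂ y≡)
    ... | tri< lt _ _ | adj = close adj lt
    ... | tri≈ _ eq _ | _ = contradiction (cong toℕ (⟨$⟩ʳ-injective τ eq)) (ℕ.<⇒≢ (ℕ.≤-reflexive (sym y≡)))
    ... | tri> _ _ gt | adj = swap (close (adjacent-sym adj) gt)
      where
      swap : ∀ {n} {a b : Fin n} → CyclicallyAdjacent a b → CyclicallyAdjacent b a
      swap (inj₁ e) = inj₂ e
      swap (inj₂ e) = inj₁ e

theorem4p13 : (n : ℕ) (R : BlockRel n) → IsEquivalence R →
    (∃ λ a → ∃ λ b → ¬ R a b) →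
    (∀ a → ∃ λ b → b ≢ a × R a b) →
    (i : ℕ) → 2 ≤ i →
    ((¬ AutF R δ) → (¬ AutF R ζ) →
    ∀ (τ : Permutation′ (i + n)) → (Comp (i + n) (Aut R) τ ⇔ SP (iter i R) τ))
    × (AutF R δ → (¬ AutF R ζ) →
    ∀ (τ : Permutation′ (i + n)) → (Comp (i + n) (Aut R) τ ⇔ SPδ (iter i R) τ))
    × (AutF R ζ →
    ∀ (τ : Permutation′ (i + n)) → (Comp (i + n) (Aut R) τ ⇔ D (i + n) τ))
-- Two unrelated points force n ≥ 2.
theorem4p13 zero _ _ (() , _)
theorem4p13 (suc zero) _ eqv (zero , zero , ¬r) = contradiction (IsEquivalence.refl eqv) ¬r
theorem4p13 n@(suc (suc k)) R eqv apart mate (suc I) (s≤s 0<I) = trivialCase , reflectionCase , dihedralCase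
  where
  trivialCase : ¬ AutF R δ → ¬ AutF R ζ → ∀ τ → Comp (suc I + n) (Aut R) τ ⇔ SP (iter (suc I) R) τ
  trivialCase ¬δ ¬ζ τ = mk⇔ fwd (sp⇒comp eqv I τ)
    where
    fwd : Comp (suc I + n) (Aut R) τ → SP (iter (suc I) R) τ
    fwd τ∈ with comp⇒sp⊎sp eqv mate 0<I ¬ζ τ τ∈
    ... | inj₁ sp = sp
    ... | inj₂ sp = contradiction (sp-reverse⇒autδ eqv mate 0<I ¬ζ τ τ∈ sp) ¬δ

  reflectionCase : AutF R δ → ¬ AutF R ζ → ∀ τ → Comp (suc I + n) (Aut R) τ ⇔ SPδ (iter (suc I) R) τ
  reflectionCase autδ ¬ζ τ = mk⇔ fwd
      (comp-gen eqv λ { {π} (inj₁ sp) → sp⇒comp eqv I π sp ; {π} (inj₂ π≐δ) → comp-δ eqv autδ {π = π} π≐δ })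
    where
    fwd : Comp (suc I + n) (Aut R) τ → SPδ (iter (suc I) R) τ
    fwd τ∈ with comp⇒sp⊎sp eqv mate 0<I ¬ζ τ τ∈
    ... | inj₁ sp = gen (inj₁ sp)
    ... | inj₂ sp = ext {σ = reverse ∘ₚ (reverse ∘ₚ τ)} (λ x → cong (τ ⟨$⟩ʳ_) (opposite-involutive x))
        (comp {σ = reverse} {τ = reverse ∘ₚ τ} (gen (inj₂ λ _ → refl)) (gen (inj₁ sp)))

  dihedralCase : AutF R ζ → ∀ τ → Comp (suc I + n) (Aut R) τ ⇔ D (suc I + n) τ
  dihedralCase autζ τ = mk⇔ (comp⇒D eqv mate apart autζ 0<I τ) (D⇒comp eqv autζ {π = τ})
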